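{- Let $f(\mathbf x)\in\mathbb F[x_1,\dots,x_n]^k$ be a polynomial over $\mathbb F^k$ of degree $d$, and let $\mathbf w=(w_1,\dots,w_n)$ be a basis isolating weight assignment of $f$. Then $f(\mathbf x+t^{\mathbf w}):=f(x_1+t^{w_1},\dots,x_n+t^{w_n})\in\mathbb F(t)[\mathbf x]^k$ has a cone-closed basis over $\mathbb F(t)$.
   Context: Throughout, $\mathbb F=\mathbb Q$. A polynomial $f\in\mathbb F[\mathbf x]^k$ is a polynomial whose coefficients $\mathrm{coef}_{\mathbf x^{\mathbf e}}(f)$ are vectors in $\mathbb F^k$ (similarly over $\mathbb F(t)$); $\mathrm{lrsp}(f)$ is the linear span of its coefficients. A monomial $\mathbf x^{\mathbf e}$ is a submonomial of $\mathbf x^{\mathbf f}$ if $\mathbf e\le\mathbf f$ coordinatewise; a set of monomials is cone-closed if it contains all submonomials of each of its elements. $f$ has a cone-closed basis if there is a cone-closed set of monomials $B$ whose coefficients in $f$ form a basis of $\mathrm{lrsp}(f)$. A weight assignment $\mathbf w\in\mathbb Z_{\ge0}^n$ gives monomial weights $\mathbf w(\mathbf x^{\mathbf e})=\sum_ie_iw_i$. $\mathbf w$ is a basis isolating weight assignment for $f$ if there is a set of monomials $B$ whose coefficients form a basis of $\mathrm{lrsp}(f)$ such that (1) the weights of the monomials in $B$ are pairwise distinct, and (2) for every monomial $m$ in the support of $f$ not in $B$, $\mathrm{coef}_m(f)$ lies in the span of $\{\mathrm{coef}_{m'}(f): m'\in B,\ \mathbf w(m')<\mathbf w(m)\}$.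 -}

module Defs where

open import Data.Nat as ℕ using (ℕ; zero; suc; _≤_; _<_; _≤?_; _≥_)
open import Data.Nat.Combinatorics using (_C_)
open import Data.Integer using (+_)
open import Data.Rational as Q using (ℚ; 0ℚ; 1ℚ; _/_)
open import Data.Fin using (Fin; zero; suc)
open import Data.Vec as V using (Vec; []; _∷_)
open import Data.Vec.Properties using (≡-dec)
open import Data.Vec.Relation.Binary.Pointwise.Inductive as PW using (Pointwise)
open import Data.List as L using (List; []; _∷_; length; lookup; replicate; _++_)
open import Data.List.Membership.Propositional using (_∈_; _∉_)
open import Data.List.Relation.Unary.All using (All)
open import Data.Product using (Σ; _×_; _,_; ∃)
open import Relation.Nullary using (¬_; yes; no)
open import Relation.Binary.PropositionalEquality using (_≡_)

Exp : ℕ → Set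
Exp n = Vec ℕ n

_≼_ : ∀ {n} → Exp n → Exp n → Set
e ≼ f = Pointwise _≤_ e f

weight : ∀ {n} → Vec ℕ n → Exp n → ℕ
weight w e = V.sum (V.zipWith ℕ._*_ w e)

-- Vectors in 𝔽ᵏ (𝔽 = ℚ) and polynomials in 𝔽[x]ᵏ (a finite list of
-- terms  c · x^e  with c ∈ ℚᵏ; equal exponents may repeat, coefficients add up).

QVec : ℕ → Set
QVec k = Fin k → ℚ

Poly : ℕ → ℕ → Set
Poly n k = List (Exp n × QVec k)

coef : ∀ {n k} → Poly n k → Exp n → QVec k
coef [] e i = 0ℚ
coef ((m , c) ∷ f) e i with ≡-dec ℕ._≟_ m e
... | yes _ = c i Q.+ coef f e i
... | no  _ = coef f e i

IsZeroVec : ∀ {k} → QVec k → Set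
IsZeroVec v = ∀ i → v i ≡ 0ℚ

lincomb : ∀ {r k} → (Fin r → ℚ) → (Fin r → QVec k) → QVec k
lincomb {zero}  c v i = 0ℚ
lincomb {suc r} c v i = (c zero Q.* v zero i) Q.+ lincomb (λ j → c (suc j)) (λ j → v (suc j)) i

LinIndep : ∀ {r k} → (Fin r → QVec k) → Set
LinIndep {r} v = (c : Fin r → ℚ) → IsZeroVec (lincomb c v) → ∀ j → c j ≡ 0ℚ

coefsAt : ∀ {n k} → Poly n k → (B : List (Exp n)) → Fin (length B) → QVec k
coefsAt f B j = coef f (lookup B j)

BasisIsolating : ∀ {n k} → Vec ℕ n → Poly n k → Set
BasisIsolating {n} {k} w f =
  Σ (List (Exp n)) λ B →
    LinIndep (coefsAt f B)
    × (∀ m → Σ (Fin (length B) → ℚ) λ c → ∀ i → coef f m i ≡ lincomb c (coefsAt f B) i)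
    × (∀ i j → weight w (lookup B i) ≡ weight w (lookup B j) → i ≡ j)
    × (∀ m → ¬ IsZeroVec (coef f m) → m ∉ B →
         Σ (Fin (length B) → ℚ) λ c →
           (∀ j → weight w (lookup B j) ≥ weight w m → c j ≡ 0ℚ)
           × (∀ i → coef f m i ≡ lincomb c (coefsAt f B) i))

-- 𝔽[t] as coefficient lists (lowest degree first), and 𝔽(t) as fractions.

QPoly : Set
QPoly = List ℚ

coeffAt : QPoly → ℕ → ℚ
coeffAt []      _       = 0ℚ
coeffAt (a ∷ p) zero    = a
coeffAt (a ∷ p) (suc i) = coeffAt p i

_≈P_ : QPoly → QPoly → Set
p ≈P q = ∀ i → coeffAt p i ≡ coeffAt q i

IsZeroP : QPoly → Set
IsZeroP p = All (_≡ 0ℚ) p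

_+P_ : QPoly → QPoly → QPoly
[]      +P q       = q
(a ∷ p) +P []      = a ∷ p
(a ∷ p) +P (b ∷ q) = (a Q.+ b) ∷ (p +P q)

scaleP : ℚ → QPoly → QPoly
scaleP c p = L.map (c Q.*_) p

_*P_ : QPoly → QPoly → QPoly
[]      *P q = []
(a ∷ p) *P q = scaleP a q +P (0ℚ ∷ (p *P q))

monoT : ℚ → ℕ → QPoly
monoT c a = replicate a 0ℚ ++ (c ∷ [])

record RatFun : Set where
  constructor _⟋_∣_
  field
    num : QPoly
    den : QPoly
    den≢0 : ¬ IsZeroP den
open RatFun public

_≈R_ : RatFun → RatFun → Set
x ≈R y = (num x *P den y) ≈P (num y *P den x)

one≢0 : ¬ IsZeroP (1ℚ ∷ [])
one≢0 (All._∷_ () _)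

0R : RatFun
0R = [] ⟋ (1ℚ ∷ []) ∣ one≢0

embed : QPoly → RatFun
embed p = p ⟋ (1ℚ ∷ []) ∣ one≢0

PVec : ℕ → Set
PVec k = Fin k → QPoly

-- Σ_j a_j v_j ∈ 𝔽(t)ᵏ  (a_j ∈ 𝔽(t), v_j ∈ 𝔽[t]ᵏ), computed in the field of
-- fractions as a pair (numerator , denominator); the denominator is a product
-- of the (nonzero) denominators of the a_j, hence nonzero.
lincombR : ∀ {r k} → (Fin r → RatFun) → (Fin r → PVec k) → Fin k → QPoly × QPoly
lincombR {zero}  a v i = ([] , 1ℚ ∷ [])
lincombR {suc r} a v i with lincombR (λ j → a (suc j)) (λ j → v (suc j)) i
... | (p' , q') = (((num (a zero) *P v zero i) *P q') +P (p' *P den (a zero))) , (den (a zero) *P q')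

_≈F_ : QPoly × QPoly → QPoly × QPoly → Set
(p , q) ≈F (p' , q') = (p *P q') ≈P (p' *P q)

InSpanT : ∀ {r k} → PVec k → (Fin r → PVec k) → Set
InSpanT {r} v u = Σ (Fin r → RatFun) λ a → ∀ i → (v i , 1ℚ ∷ []) ≈F lincombR a u i

LinIndepT : ∀ {r k} → (Fin r → PVec k) → Set
LinIndepT {r} u = (a : Fin r → RatFun) → (∀ i → lincombR a u i ≈F ([] , 1ℚ ∷ [])) →
  ∀ j → IsZeroP (num (a j))

-- f(x + t^w): by the binomial theorem, the coefficient of x^e is
--   Σ_{terms c·x^m of f, e ≤ m}  (Π_i C(m_i, e_i)) · t^{w·(m − e)} · c.

binomProd : ∀ {n} → Exp n → Exp n → ℕ
binomProd [] [] = 1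
binomProd (m ∷ ms) (e ∷ es) = (m C e) ℕ.* binomProd ms es

shiftCoef : ∀ {n k} → Vec ℕ n → Poly n k → Exp n → PVec k
shiftCoef w [] e i = []
shiftCoef w ((m , c) ∷ f) e i with PW.decidable _≤?_ e m
... | yes _ = monoT ((+ binomProd m e / 1) Q.* c i) (weight w (V.zipWith ℕ._∸_ m e))
                +P shiftCoef w f e i
... | no  _ = shiftCoef w f e i

-- a polynomial over 𝔽(t)ᵏ (given by its coefficient function, with coefficients
-- in 𝔽[t]ᵏ ⊆ 𝔽(t)ᵏ) has a cone-closed basis
HasConeClosedBasis : ∀ {n k} → (Exp n → PVec k) → Set
HasConeClosedBasis {n} g =
  Σ (List (Exp n)) λ B →
    (∀ {m e} → m ∈ B → e ≼ m → e ∈ B)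
    × LinIndepT (λ j → g (lookup B j))
    × (∀ m → InSpanT (g m) (λ j → g (lookup B j)))

-- For a finite set B ⊂ ℕⁿ there is a cone-closed set A with |A| = |B| such that the
-- matrix C(b, a) (a ∈ A, b ∈ B) is invertible. A consists of the lexicographic
-- standard monomials of B, built one coordinate at a time: with
-- P_j = { p : more than j points of B lie over p }, it is ⋃_j {j} × A(P_j).
-- Expanding f in its isolating basis B, the coefficient of x^a in f(x + t^w) is
--   Σ_b t^(w(b) − w(a)) (C(b, a) + O(t)) coef_b(f),
-- because only monomials m with w(m) > w(b), and b itself, involve coef_b(f).
-- So the coefficients indexed by A are independent, and there are as many of them
-- as the dimension, hence they span.
module Submission where

open import Defs
open import Data.Nat as ℕ using (ℕ; zero; suc; _≤_; _<_; z≤n; s≤s; s≤s⁻¹; _∸_)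
open import Data.Nat.Properties as ℕP using (<-≤-trans; ≤-<-trans; m≤n⇒m≤1+n; m<n⇒m<1+n; n<1+n; <-irrefl)
open import Data.Nat.Combinatorics using (_C_; nCk+nC[k+1]≡[n+1]C[k+1]; nC1≡n; k>n⇒nCk≡0)
open import Data.Nat.Tactic.RingSolver as ℕRing using ()
open import Data.Integer as ℤ using () renaming (+_ to pos)
open import Data.Integer.Properties as ℤP using ()
open import Data.Rational as Q using (ℚ; 0ℚ; 1ℚ; _/_; 1/_; _+_; _*_; _-_)
open import Data.Rational.Properties as QP using (toℚᵘ-homo-+; toℚᵘ-homo-*; toℚᵘ-fromℚᵘ)
open import Data.Rational.Unnormalised as U using (mkℚᵘ; *≡*)
open import Data.Rational.Unnormalised.Properties as UP using ()
open import Data.Fin using (Fin; zero; suc; punchIn)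
open import Data.Fin.Properties as FP using (any?)
open import Data.Vec as V using (Vec; []; _∷_)
open import Data.Vec.Functional using (insertAt)
open import Data.Vec.Functional.Properties using (insertAt-lookup; insertAt-punchIn)
open import Data.Vec.Properties using (≡-dec)
open import Data.Vec.Relation.Binary.Pointwise.Inductive as PW using ([]; _∷_)
open import Data.List as L using (List; []; _∷_; length; lookup; _++_)
open import Data.List.Properties using (length-++; tabulate-lookup)
open import Data.List.Membership.Propositional using (_∈_; _∉_)
open import Data.List.Membership.Propositional.Properties using (∈-∃++; ∈-++⁻; ∈-++⁺ˡ; ∈-++⁺ʳ; ∈-lookup; ∈-deduplicate⁺; ∈-map⁺)
open import Data.List.Relation.Binary.Subset.Propositional using (_⊆_)
open import Data.List.Relation.Unary.All as All using (All; []; _∷_)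
open import Data.List.Relation.Unary.All.Properties using (¬Any⇒All¬; All¬⇒¬Any)
open import Data.List.Relation.Unary.AllPairs using ([]; _∷_)
open import Data.List.Relation.Unary.Any as Any using (here; there)
open import Data.List.Relation.Unary.Any.Properties using (lookup-index)
open import Data.List.Relation.Unary.Unique.Propositional using (Unique)
open import Data.List.Relation.Unary.Unique.Propositional.Properties using (tabulate⁺)
open import Data.Product using (Σ; _×_; _,_; proj₁; proj₂; ∃)
open import Data.Sum using (inj₁; inj₂)
open import Function using (_∘_)
open import Level using (0ℓ)
open import Relation.Nullary using (¬_; Dec; yes; no; contradiction; dec⇒maybe; map′; ¬?)
open import Relation.Nullary.Decidable using (decidable-stable)
open import Relation.Binary.Bundles using (Setoid)
open import Relation.Binary.PropositionalEquality using (_≡_; _≢_; refl; sym; trans; cong; cong₂; subst; _≗_; module ≡-Reasoning)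
open import Algebra.Bundles using (CommutativeRing; CommutativeMonoid)
open import Algebra.Properties.Group QP.+-0-group using () renaming (x∙y⁻¹≈ε⇒x≈y to p-q≡0⇒p≡q)
open import Algebra.Properties.Semiring.Sum (CommutativeRing.semiring QP.+-*-commutativeRing) as QS using (sum)
open import Tactic.RingSolver using (solve-∀)
open import Tactic.RingSolver.Core.AlmostCommutativeRing using (AlmostCommutativeRing; fromCommutativeRing)

-- `B` need not be cone-closed, so its exponents are traded for others. The trade is admissible when
-- no nonzero combination of the functions b ↦ C(b, a), a ∈ A, vanishes on all of `B`. For standard
-- monomials this is a root count: over a point of P_J there are more than J points of `B`, too many
-- roots for degree J in the first variable, so the top coefficient vanishes there and the levels
-- can be removed from the highest down. Characteristic 0 enters here: C(x, j) has degree exactly j,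
-- and distinct naturals stay distinct in ℚ. No determinant or inverse matrix is formed. Scaling
-- rows and columns by powers of t gives a polynomial matrix whose value at t = 0 is the binomial
-- matrix, and injectivity at t = 0 passes to ℚ[t] by repeatedly dividing a relation by t. Spanning
-- is a count: |B| + 1 vectors with |B| coordinates satisfy a relation, and injectivity forces a
-- nonzero coefficient on the additional vector.

private variable n k : ℕ

-- Standard monomials of a finite set of exponents

_≟E_ : (e e' : Exp n) → Dec (e ≡ e')
_≟E_ = ≡-dec ℕ._≟_

length-mono-⊆ : ∀ {A : Set} {xs ys : List A} → Unique xs → xs ⊆ ys → length xs ≤ length ys
length-mono-⊆ {xs = []} _ _ = z≤n
length-mono-⊆ {xs = x ∷ xs} (x∉ ∷ u) s with ∈-∃++ (s (here refl))
... | us , vs , refl = subst (suc (length xs) ≤_) (sym len) (s≤s (length-mono-⊆ u s'))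
  where
  len : length (us ++ x ∷ vs) ≡ suc (length (us ++ vs))
  len = trans (length-++ us) (trans (ℕP.+-suc _ _) (cong suc (sym (length-++ us))))
  s' : xs ⊆ us ++ vs
  s' y∈ with ∈-++⁻ us (s (there y∈))
  ... | inj₁ p = ∈-++⁺ˡ p
  ... | inj₂ (here refl) = contradiction y∈ (All¬⇒¬Any x∉)
  ... | inj₂ (there p) = ∈-++⁺ʳ us p

fibre : Exp n → List (Exp (suc n)) → List ℕ
fibre p [] = []
fibre p ((x ∷ q) ∷ B) with q ≟E p
... | yes _ = x ∷ fibre p B
... | no  _ = fibre p B

height : Exp n → List (Exp (suc n)) → ℕ
height p B = length (fibre p B)

-- A tail is recorded at the point that has exactly `j` points over the same tail behind it in the
-- list. So it appears once, and precisely when its fibre has more than `j` points: this is P_j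
-- without repetitions.
layer : ℕ → List (Exp (suc n)) → List (Exp n)
layer j [] = []
layer j ((x ∷ q) ∷ B) with height q B ℕ.≟ j
... | yes _ = q ∷ layer j B
... | no  _ = layer j B

-- Prepending `x ∷ p` changes a single layer: with h the number of points already over `p`, layer h
-- gains `p`. Hence exactly one monomial is added, with first coordinate h, and |A| = |B| holds by
-- construction.
newStd : List (Exp n) → Exp n → Exp n
newStd B []      = []
newStd B (x ∷ p) = height p B ∷ newStd (layer (height p B) B) p

std : List (Exp n) → List (Exp n)
std []      = []
std (b ∷ B) = newStd B b ∷ std B

length-std : (B : List (Exp n)) → length (std B) ≡ length B
length-std []      = refl
length-std (b ∷ B) = cong suc (length-std B)

∈-fibre⁺ : ∀ {x} {p : Exp n} {B} → (x ∷ p) ∈ B → x ∈ fibre p B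
∈-fibre⁺ {p = p} {(y ∷ q) ∷ B} b∈ with q ≟E p | b∈
... | yes _ | here refl = here refl
... | yes _ | there i   = there (∈-fibre⁺ i)
... | no q≢p | here refl = contradiction refl q≢p
... | no _ | there i   = ∈-fibre⁺ i

∈-fibre⁻ : ∀ {x} {p : Exp n} {B} → x ∈ fibre p B → (x ∷ p) ∈ B
∈-fibre⁻ {p = p} {(y ∷ q) ∷ B} x∈ with q ≟E p | x∈
... | yes refl | here refl = here refl
... | yes _ | there i   = there (∈-fibre⁻ i)
... | no _  | i         = there (∈-fibre⁻ i)

fibre-unique : ∀ (p : Exp n) {B} → Unique B → Unique (fibre p B)
fibre-unique p {[]} _ = []
fibre-unique p {(y ∷ q) ∷ B} (b∉ ∷ u) with q ≟E p
... | yes refl = ¬Any⇒All¬ _ (All¬⇒¬Any b∉ ∘ ∈-fibre⁻) ∷ fibre-unique p u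
... | no _     = fibre-unique p u

height≤length : ∀ (p : Exp n) B → height p B ≤ length B
height≤length p [] = z≤n
height≤length p ((y ∷ q) ∷ B) with q ≟E p
... | yes _ = s≤s (height≤length p B)
... | no  _ = m≤n⇒m≤1+n (height≤length p B)

height-mono : ∀ (p : Exp n) {P Q} → Unique P → P ⊆ Q → height p P ≤ height p Q
height-mono p u s = length-mono-⊆ (fibre-unique p u) (∈-fibre⁺ ∘ s ∘ ∈-fibre⁻)

∈-layer⁻ : ∀ {j} {p : Exp n} B → p ∈ layer j B → j < height p B
∈-layer⁻ {j = j} {p} ((y ∷ q) ∷ B) p∈ with height q B ℕ.≟ j | q ≟E p | p∈
... | yes refl | yes refl | _ = n<1+n _
... | yes _ | no q≢p | here refl = contradiction refl q≢p
... | yes _ | no _ | there i = ∈-layer⁻ B i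
... | no _  | yes _ | i = m<n⇒m<1+n (∈-layer⁻ B i)
... | no _  | no _ | i = ∈-layer⁻ B i

∈-layer⁺ : ∀ {j} {p : Exp n} B → j < height p B → p ∈ layer j B
∈-layer⁺ {j = j} {p} ((y ∷ q) ∷ B) j<h with height q B ℕ.≟ j | q ≟E p
... | yes _ | yes refl = here refl
... | yes _ | no _ = there (∈-layer⁺ B j<h)
... | no h≢j | yes refl = ∈-layer⁺ B (ℕP.≤∧≢⇒< (s≤s⁻¹ j<h) (h≢j ∘ sym))
... | no _ | no _ = ∈-layer⁺ B j<h

layer-unique : ∀ j (B : List (Exp (suc n))) → Unique (layer j B)
layer-unique j [] = []
layer-unique j ((y ∷ q) ∷ B) with height q B ℕ.≟ j
... | yes refl = ¬Any⇒All¬ _ (<-irrefl refl ∘ ∈-layer⁻ B) ∷ layer-unique _ B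
... | no _     = layer-unique j B

∈-std⁻ : ∀ {j} {e : Exp n} B → (j ∷ e) ∈ std B → e ∈ std (layer j B)
∈-std⁻ {j = j} ((y ∷ q) ∷ B) a∈ with height q B ℕ.≟ j | a∈
... | yes refl | here refl = here refl
... | no h≢j   | here refl = contradiction refl h≢j
... | yes _    | there i   = there (∈-std⁻ B i)
... | no _     | there i   = ∈-std⁻ B i

∈-std⁺ : ∀ {j} {e : Exp n} B → e ∈ std (layer j B) → (j ∷ e) ∈ std B
∈-std⁺ {j = j} ((y ∷ q) ∷ B) e∈ with height q B ℕ.≟ j | e∈
... | yes refl | here refl = here refl
... | yes _    | there i   = there (∈-std⁺ B i)
... | no _     | i         = there (∈-std⁺ B i)

-- Larger sets have higher fibres, hence larger layers, to which induction on the dimension applies.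
-- In particular the order of a duplicate-free list does not affect which monomials arise.
std-mono : ∀ {P Q : List (Exp n)} → Unique P → P ⊆ Q → std P ⊆ std Q
std-mono {P = []} _ _ ()
std-mono {zero} {P = [] ∷ _} {Q = []} _ s {[]} _ = contradiction (s (here refl)) λ ()
std-mono {zero} {Q = [] ∷ _} _ _ {[]} _ = here refl
std-mono {suc n} {P@(_ ∷ _)} {Q} u s {j ∷ e} a∈ =
  ∈-std⁺ Q (std-mono (layer-unique j P) (λ p∈ → ∈-layer⁺ Q (<-≤-trans (∈-layer⁻ P p∈) (height-mono _ u s))) (∈-std⁻ P a∈))

-- The layers shrink as their index grows, so the first coordinate may be lowered; the others are
-- lowered by induction inside one layer.
std-coneClosed : ∀ (B : List (Exp n)) {m e} → m ∈ std B → e ≼ m → e ∈ std B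
std-coneClosed B {[]} {[]} m∈ [] = m∈
std-coneClosed B {i ∷ m} {j ∷ e} m∈ (j≤i ∷ e≼m) = ∈-std⁺ B
  (std-mono (layer-unique i B) (λ p∈ → ∈-layer⁺ B (≤-<-trans j≤i (∈-layer⁻ B p∈)))
    (std-coneClosed (layer i B) (∈-std⁻ B m∈) e≼m))

newStd-∉ : ∀ {b : Exp n} {B} → b ∉ B → newStd B b ∉ std B
newStd-∉ {b = []} {[]} _ ()
newStd-∉ {b = []} {[] ∷ _} b∉ _ = b∉ (here refl)
newStd-∉ {b = x ∷ p} {B} b∉ a∈ = newStd-∉ (<-irrefl refl ∘ ∈-layer⁻ B) (∈-std⁻ B a∈)

std-unique : ∀ {B : List (Exp n)} → Unique B → Unique (std B)
std-unique []       = []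
std-unique (b∉ ∷ u) = ¬Any⇒All¬ _ (newStd-∉ (All¬⇒¬Any b∉)) ∷ std-unique u

-- Values of binomial polynomials

ℚ-ring : AlmostCommutativeRing 0ℓ 0ℓ
ℚ-ring = fromCommutativeRing QP.+-*-commutativeRing (λ x → dec⇒maybe (0ℚ QP.≟ x))

-- Opaque, since unification would otherwise unfold it to a gcd computation.
opaque
  ι : ℕ → ℚ
  ι m = pos m / 1

  ι-def : ∀ m → pos m / 1 ≡ ι m
  ι-def m = refl

  toℚᵘ-ι : ∀ m → Q.toℚᵘ (ι m) U.≃ mkℚᵘ (pos m) 0
  toℚᵘ-ι m = toℚᵘ-fromℚᵘ (mkℚᵘ (pos m) 0)

ι-+ : ∀ a b → ι (a ℕ.+ b) ≡ ι a + ι b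
ι-+ a b = QP.toℚᵘ-injective (begin
  Q.toℚᵘ (ι (a ℕ.+ b))                ≈⟨ toℚᵘ-ι (a ℕ.+ b) ⟩
  mkℚᵘ (pos (a ℕ.+ b)) 0                ≈⟨ *≡* (cong (ℤ._* pos 1) (cong₂ ℤ._+_ (sym (ℤP.*-identityʳ (pos a))) (sym (ℤP.*-identityʳ (pos b))))) ⟩
  mkℚᵘ (pos a) 0 U.+ mkℚᵘ (pos b) 0       ≈⟨ UP.+-cong (toℚᵘ-ι a) (toℚᵘ-ι b) ⟨
  Q.toℚᵘ (ι a) U.+ Q.toℚᵘ (ι b)       ≈⟨ toℚᵘ-homo-+ (ι a) (ι b) ⟨
  Q.toℚᵘ (ι a + ι b)                  ∎)
  where open UP.≃-Reasoning

ι-* : ∀ a b → ι (a ℕ.* b) ≡ ι a * ι b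
ι-* a b = QP.toℚᵘ-injective (begin
  Q.toℚᵘ (ι (a ℕ.* b))                ≈⟨ toℚᵘ-ι (a ℕ.* b) ⟩
  mkℚᵘ (pos (a ℕ.* b)) 0                ≈⟨ *≡* (cong (ℤ._* pos 1) (ℤP.pos-* a b)) ⟩
  mkℚᵘ (pos a) 0 U.* mkℚᵘ (pos b) 0       ≈⟨ UP.*-cong (toℚᵘ-ι a) (toℚᵘ-ι b) ⟨
  Q.toℚᵘ (ι a) U.* Q.toℚᵘ (ι b)       ≈⟨ toℚᵘ-homo-* (ι a) (ι b) ⟨
  Q.toℚᵘ (ι a * ι b)                  ∎)
  where open UP.≃-Reasoning

ι-injective : ∀ {a b} → ι a ≡ ι b → a ≡ b
ι-injective {a} {b} eq = ℤP.+-injective (trans (sym (ℤP.*-identityʳ (pos a))) (trans (UP.drop-*≡* (begin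
  mkℚᵘ (pos a) 0 ≈⟨ toℚᵘ-ι a ⟨
  Q.toℚᵘ (ι a) ≡⟨ cong Q.toℚᵘ eq ⟩
  Q.toℚᵘ (ι b) ≈⟨ toℚᵘ-ι b ⟩
  mkℚᵘ (pos b) 0 ∎)) (ℤP.*-identityʳ (pos b))))
  where open UP.≃-Reasoning

*-integral : ∀ p {q} → p * q ≡ 0ℚ → p ≢ 0ℚ → q ≡ 0ℚ
*-integral p {q} pq≡0 p≢0 = begin
  q                ≡⟨ QP.*-identityˡ q ⟨
  1ℚ * q           ≡⟨ cong (_* q) (QP.*-inverseˡ p) ⟨
  (1/ p) * p * q   ≡⟨ QP.*-assoc (1/ p) p q ⟩
  (1/ p) * (p * q) ≡⟨ cong ((1/ p) *_) pq≡0 ⟩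
  (1/ p) * 0ℚ      ≡⟨ QP.*-zeroʳ (1/ p) ⟩
  0ℚ               ∎
  where
  open ≡-Reasoning
  instance
    p-nonZero : Q.NonZero p
    p-nonZero = Q.≢-nonZero p≢0

-- Keeping j C(x, j) on the left avoids the truncated x ∸ j. Over ℚ this becomes the recursion from
-- C(x, j) to C(x, j + 1).
absorption : ∀ x j → suc j ℕ.* (x C suc j) ℕ.+ j ℕ.* (x C j) ≡ x ℕ.* (x C j)
absorption x zero = trans (ℕP.+-identityʳ _) (trans (ℕP.*-identityˡ _) (trans (nC1≡n x) (sym (ℕP.*-identityʳ x))))
absorption zero (suc j) = cong₂ ℕ._+_ (zeroC (suc j)) (zeroC j)
  where
  zeroC : ∀ j → suc j ℕ.* (0 C suc j) ≡ 0
  zeroC j = trans (cong (suc j ℕ.*_) (k>n⇒nCk≡0 {0} {suc j} (s≤s z≤n))) (ℕP.*-zeroʳ (suc j))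
absorption (suc x) (suc j) = begin
  suc (suc j) ℕ.* (suc x C suc (suc j)) ℕ.+ suc j ℕ.* (suc x C suc j)
    ≡⟨ cong₂ (λ u v → suc (suc j) ℕ.* u ℕ.+ suc j ℕ.* v) (nCk+nC[k+1]≡[n+1]C[k+1] x (suc j)) (nCk+nC[k+1]≡[n+1]C[k+1] x j) ⟨
  suc (suc j) ℕ.* (b ℕ.+ c) ℕ.+ suc j ℕ.* (a ℕ.+ b)
    ≡⟨ lem₁ j a b c ⟩
  suc (suc j) ℕ.* c ℕ.+ suc j ℕ.* b ℕ.+ (suc j ℕ.* b ℕ.+ j ℕ.* a) ℕ.+ (a ℕ.+ b)
    ≡⟨ cong₂ (λ u v → u ℕ.+ v ℕ.+ (a ℕ.+ b)) (absorption x (suc j)) (absorption x j) ⟩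
  x ℕ.* b ℕ.+ x ℕ.* a ℕ.+ (a ℕ.+ b)
    ≡⟨ lem₂ x a b ⟩
  suc x ℕ.* (a ℕ.+ b)
    ≡⟨ cong (suc x ℕ.*_) (nCk+nC[k+1]≡[n+1]C[k+1] x j) ⟩
  suc x ℕ.* (suc x C suc j) ∎
  where
  open ≡-Reasoning
  a = x C j
  b = x C suc j
  c = x C suc (suc j)
  lem₁ : ∀ j a b c → suc (suc j) ℕ.* (b ℕ.+ c) ℕ.+ suc j ℕ.* (a ℕ.+ b)
    ≡ suc (suc j) ℕ.* c ℕ.+ suc j ℕ.* b ℕ.+ (suc j ℕ.* b ℕ.+ j ℕ.* a) ℕ.+ (a ℕ.+ b)
  lem₁ = ℕRing.solve-∀
  lem₂ : ∀ x a b → x ℕ.* b ℕ.+ x ℕ.* a ℕ.+ (a ℕ.+ b) ≡ suc x ℕ.* (a ℕ.+ b)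
  lem₂ = ℕRing.solve-∀

-- Polynomial functions of degree at most J whose coefficient at x^J is ℓ,
-- described through their difference quotients.
IsPoly : ℕ → (ℕ → ℚ) → ℚ → Set
IsPoly zero    f ℓ = ∀ x → f x ≡ ℓ
IsPoly (suc J) f ℓ = ∀ a → Σ (ℕ → ℚ) λ g → IsPoly J g ℓ × (∀ x → f x ≡ f a + (ι x - ι a) * g x)

-- Dividing out one root leaves a quotient of lower degree with the same top coefficient; the
-- remaining points are still roots because they differ from the one removed.
isPoly-roots : ∀ J {f ℓ xs} → IsPoly J f ℓ → Unique xs → J < length xs → All (λ x → f x ≡ 0ℚ) xs → ℓ ≡ 0ℚ
isPoly-roots zero {xs = x ∷ xs} P _ _ (fx≡0 ∷ _) = trans (sym (P x)) fx≡0
isPoly-roots (suc J) {f} {xs = a ∷ xs} P (a∉ ∷ u) (s≤s J<) (fa≡0 ∷ zs) =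
  isPoly-roots J Pg u J< (All.zipWith root (a∉ , zs))
  where
  g = proj₁ (P a)
  Pg = proj₁ (proj₂ (P a))
  eq = proj₂ (proj₂ (P a))
  root : ∀ {x} → a ≢ x × f x ≡ 0ℚ → g x ≡ 0ℚ
  root {x} (a≢x , fx≡0) = *-integral (ι x - ι a)
    (trans (sym (QP.+-identityˡ _)) (trans (cong (_+ (ι x - ι a) * g x) (sym fa≡0)) (trans (sym (eq x)) fx≡0)))
    (λ d → a≢x (sym (ι-injective (p-q≡0⇒p≡q (ι x) (ι a) d))))

isPoly-cong : ∀ J {f f' ℓ} → f ≗ f' → IsPoly J f ℓ → IsPoly J f' ℓ
isPoly-cong zero e P x = trans (sym (e x)) (P x)
isPoly-cong (suc J) e P a with P a
... | g , Pg , eq = g , Pg , λ x → trans (sym (e x)) (trans (eq x) (cong (_+ _) (e a)))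

isPoly-raise : ∀ J {f ℓ} → IsPoly J f ℓ → IsPoly (suc J) f 0ℚ
isPoly-raise zero {f} P a = (λ _ → 0ℚ) , (λ _ → refl) , λ x → begin
  f x ≡⟨ trans (P x) (sym (P a)) ⟩
  f a ≡⟨ lem (f a) (ι x - ι a) ⟩
  f a + (ι x - ι a) * 0ℚ ∎
  where
  open ≡-Reasoning
  lem : ∀ y z → y ≡ y + z * 0ℚ
  lem = solve-∀ ℚ-ring
isPoly-raise (suc J) P a with P a
... | g , Pg , eq = g , isPoly-raise J Pg , eq

isPoly-+ : ∀ J {f f' ℓ ℓ'} → IsPoly J f ℓ → IsPoly J f' ℓ' → IsPoly J (λ x → f x + f' x) (ℓ + ℓ')
isPoly-+ zero P P' x = cong₂ _+_ (P x) (P' x)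
isPoly-+ (suc J) {f} {f'} P P' a with P a | P' a
... | g , Pg , eq | g' , Pg' , eq' = (λ x → g x + g' x) , isPoly-+ J Pg Pg' , λ x →
  trans (cong₂ _+_ (eq x) (eq' x)) (lem (f a) (f' a) (ι x - ι a) (g x) (g' x))
  where
  lem : ∀ u u' d v v' → u + d * v + (u' + d * v') ≡ u + u' + d * (v + v')
  lem = solve-∀ ℚ-ring

isPoly-scale : ∀ J {f ℓ} c → IsPoly J f ℓ → IsPoly J (λ x → f x * c) (ℓ * c)
isPoly-scale zero c P x = cong (_* c) (P x)
isPoly-scale (suc J) {f} c P a with P a
... | g , Pg , eq = (λ x → g x * c) , isPoly-scale J c Pg , λ x →
  trans (cong (_* c) (eq x)) (lem (f a) (ι x - ι a) (g x) c)
  where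
  lem : ∀ u d v c → (u + d * v) * c ≡ u * c + d * (v * c)
  lem = solve-∀ ℚ-ring

isPoly-const : ∀ J c → IsPoly (suc J) (λ _ → c) 0ℚ
isPoly-const zero    c = isPoly-raise 0 (λ _ → refl)
isPoly-const (suc J) c = isPoly-raise (suc J) (isPoly-const J c)

-- If g is the quotient of f at a, then the quotient of (x - s) f(x) at a is f(a) + (x - s) g(x),
-- whose top coefficient comes from the second summand by induction.
isPoly-linear* : ∀ J {f ℓ} s → IsPoly J f ℓ → IsPoly (suc J) (λ x → (ι x - s) * f x) ℓ
isPoly-linear* zero {f} {ℓ} s P a = (λ _ → ℓ) , (λ _ → refl) , λ x →
  trans (cong ((ι x - s) *_) (P x)) (trans (lem (ι x) s (ι a) ℓ) (cong (λ y → (ι a - s) * y + (ι x - ι a) * ℓ) (sym (P a))))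
  where
  lem : ∀ x s a ℓ → (x - s) * ℓ ≡ (a - s) * ℓ + (x - a) * ℓ
  lem = solve-∀ ℚ-ring
isPoly-linear* (suc J) {f} {ℓ} s P a with P a
... | g , Pg , eq = (λ x → f a + (ι x - s) * g x)
  , subst (IsPoly (suc J) _) (QP.+-identityˡ ℓ) (isPoly-+ (suc J) (isPoly-const J (f a)) (isPoly-linear* J s Pg))
  , λ x → trans (cong ((ι x - s) *_) (eq x)) (lem (ι x) s (ι a) (f a) (g x))
  where
  lem : ∀ x s a y z → (x - s) * (y + (x - a) * z) ≡ (a - s) * y + (x - a) * (y + (x - s) * z)
  lem = solve-∀ ℚ-ring

-- The witness is 1/j!: each step multiplies by (x - j)/(j + 1), and j + 1 is invertible in
-- characteristic 0.
isPoly-C : ∀ j → Σ ℚ λ u → u ≢ 0ℚ × IsPoly j (λ x → ι (x C j)) u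
isPoly-C zero = 1ℚ , (λ ()) , λ _ → sym (ι-def 1)
isPoly-C (suc j) with isPoly-C j
... | u , u≢0 , P = u * d , ud≢0 , isPoly-cong (suc j) eq (isPoly-scale (suc j) d (isPoly-linear* j (ι j) P))
  where
  instance
    1+j≢0 : Q.NonZero (ι (suc j))
    1+j≢0 = Q.≢-nonZero (λ e → ℕP.1+n≢0 (ι-injective {suc j} {0} (trans e (ι-def 0))))
  d = 1/ ι (suc j)
  open ≡-Reasoning
  ud≢0 : u * d ≢ 0ℚ
  ud≢0 e = u≢0 (begin
    u                     ≡⟨ QP.*-identityʳ u ⟨
    u * 1ℚ                ≡⟨ cong (u *_) (QP.*-inverseˡ (ι (suc j))) ⟨
    u * (d * ι (suc j))   ≡⟨ QP.*-assoc u d (ι (suc j)) ⟨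
    u * d * ι (suc j)     ≡⟨ cong (_* ι (suc j)) e ⟩
    0ℚ * ι (suc j)        ≡⟨ QP.*-zeroˡ (ι (suc j)) ⟩
    0ℚ                    ∎)
  eq : ∀ x → (ι x - ι j) * ι (x C j) * d ≡ ι (x C suc j)
  eq x = begin
    (ι x - ι j) * c * d                       ≡⟨ cong (_* d) (lem₁ (ι x) (ι j) c) ⟩
    (ι x * c - ι j * c) * d                   ≡⟨ cong (λ y → (y - ι j * c) * d) abs ⟨
    (ι (suc j) * c' + ι j * c - ι j * c) * d  ≡⟨ lem₂ (ι (suc j)) c' (ι j * c) d ⟩
    d * ι (suc j) * c'                        ≡⟨ cong (_* c') (QP.*-inverseˡ (ι (suc j))) ⟩
    1ℚ * c'                                   ≡⟨ QP.*-identityˡ c' ⟩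
    c'                                        ∎
    where
    c = ι (x C j)
    c' = ι (x C suc j)
    abs : ι (suc j) * c' + ι j * c ≡ ι x * c
    abs = begin
      ι (suc j) * c' + ι j * c                          ≡⟨ cong₂ _+_ (ι-* (suc j) (x C suc j)) (ι-* j (x C j)) ⟨
      ι (suc j ℕ.* (x C suc j)) + ι (j ℕ.* (x C j))     ≡⟨ ι-+ (suc j ℕ.* (x C suc j)) (j ℕ.* (x C j)) ⟨
      ι (suc j ℕ.* (x C suc j) ℕ.+ j ℕ.* (x C j))       ≡⟨ cong ι (absorption x j) ⟩
      ι (x ℕ.* (x C j))                                 ≡⟨ ι-* x (x C j) ⟩
      ι x * c                                           ∎
    lem₁ : ∀ x j c → (x - j) * c ≡ x * c - j * c
    lem₁ = solve-∀ ℚ-ring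
    lem₂ : ∀ s c t d → (s * c + t - t) * d ≡ d * s * c
    lem₂ = solve-∀ ℚ-ring

-- Injectivity of the binomial matrix on standard monomials

sumTo : ℕ → (ℕ → ℚ) → ℚ
sumTo zero    φ = 0ℚ
sumTo (suc J) φ = sumTo J φ + φ J

sumTo-cong : ∀ J {φ ψ} → φ ≗ ψ → sumTo J φ ≡ sumTo J ψ
sumTo-cong zero    e = refl
sumTo-cong (suc J) e = cong₂ _+_ (sumTo-cong J e) (e J)

sumTo-zero : ∀ J → sumTo J (λ _ → 0ℚ) ≡ 0ℚ
sumTo-zero zero    = refl
sumTo-zero (suc J) = trans (QP.+-identityʳ _) (sumTo-zero J)

isPoly-sumTo : ∀ J (d : ℕ → ℚ) → IsPoly J (λ x → sumTo J (λ j → ι (x C j) * d j)) 0ℚ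
isPoly-sumTo zero    d _ = refl
isPoly-sumTo (suc J) d = isPoly-raise J
  (isPoly-+ J (isPoly-sumTo J d) (isPoly-scale J (d J) (proj₂ (proj₂ (isPoly-C J)))))

-- The terms below J have degree less than J, so the coefficient of x^J is a nonzero multiple of
-- `d J`, and more than J roots make it zero.
topCoefficient-zero : ∀ J (d : ℕ → ℚ) {xs} → Unique xs → J < length xs →
  All (λ x → sumTo (suc J) (λ j → ι (x C j) * d j) ≡ 0ℚ) xs → d J ≡ 0ℚ
topCoefficient-zero J d u J< zs with isPoly-C J
... | ℓ , ℓ≢0 , P = *-integral ℓ (trans (sym (QP.+-identityˡ _))
  (isPoly-roots J (isPoly-+ J (isPoly-sumTo J d) (isPoly-scale J (d J) P)) u J< zs)) ℓ≢0

sumTo-update : ∀ {J h φ ψ} y → h < J → ψ h ≡ y + φ h → (∀ {j} → h ≢ j → ψ j ≡ φ j) →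
  sumTo J ψ ≡ y + sumTo J φ
sumTo-update {suc J} {h} {φ} {ψ} y h<1+J eq eq' with ℕP.m≤n⇒m<n∨m≡n (s≤s⁻¹ h<1+J)
... | inj₁ h<J = trans (cong₂ _+_ (sumTo-update y h<J eq eq') (eq' (ℕP.<⇒≢ h<J))) (QP.+-assoc y (sumTo J φ) (φ J))
... | inj₂ refl = trans (cong₂ _+_ (below J ℕP.≤-refl) eq) (lem (sumTo J φ) y (φ J))
  where
  below : ∀ I → I ≤ J → sumTo I ψ ≡ sumTo I φ
  below zero    _   = refl
  below (suc I) I<J = cong₂ _+_ (below I (ℕP.<⇒≤ I<J)) (eq' (ℕP.>⇒≢ I<J))
  lem : ∀ s y t → s + (y + t) ≡ y + (s + t)
  lem = solve-∀ ℚ-ring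

-- Grouping by first coordinate turns the evaluation at `x ∷ p` into a combination of the C(x, j).
-- The bound suffices because a first coordinate is the height of a fibre before its next point is
-- added, hence less than |B|.
sum-std : ∀ (B : List (Exp (suc n))) (φ : Exp (suc n) → ℚ) {J} → length B ≤ J →
  sum (φ ∘ lookup (std B)) ≡ sumTo J (λ j → sum (λ i → φ (j ∷ lookup (std (layer j B)) i)))
sum-std [] φ {J} _ = sym (sumTo-zero J)
sum-std ((y ∷ q) ∷ B) φ {J} B<J = trans
  (cong (φ (newStd B (y ∷ q)) +_) (sum-std B φ (ℕP.<⇒≤ B<J)))
  (sym (sumTo-update (φ (newStd B (y ∷ q))) (ℕP.≤-<-trans (height≤length q B) B<J) here-eq there-eq))
  where
  h = height q B
  F : List (Exp (suc _)) → ℕ → ℚ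
  F B j = sum (λ i → φ (j ∷ lookup (std (layer j B)) i))
  here-eq : F ((y ∷ q) ∷ B) h ≡ φ (newStd B (y ∷ q)) + F B h
  here-eq with height q B ℕ.≟ height q B
  ... | yes _ = refl
  ... | no h≢h = contradiction refl h≢h
  there-eq : ∀ {j} → h ≢ j → F ((y ∷ q) ∷ B) j ≡ F B j
  there-eq {j} h≢j with height q B ℕ.≟ j
  ... | yes h≡j = contradiction h≡j h≢j
  ... | no _    = refl

std-injective : ∀ {B : List (Exp n)} → Unique B → (c : Exp n → ℚ) →
  (∀ {b} → b ∈ B → sum (λ i → c (lookup (std B) i) * ι (binomProd b (lookup (std B) i))) ≡ 0ℚ) →
  ∀ {a} → a ∈ std B → c a ≡ 0ℚ
std-injective {zero} {[] ∷ []} _ c vanish (here refl) = begin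
  c []             ≡⟨ lem (c []) ⟩
  c [] * 1ℚ + 0ℚ   ≡⟨ cong (λ u → c [] * u + 0ℚ) (ι-def 1) ⟩
  c [] * ι 1 + 0ℚ  ≡⟨ vanish (here refl) ⟩
  0ℚ               ∎
  where
  open ≡-Reasoning
  lem : ∀ x → x ≡ x * 1ℚ + 0ℚ
  lem = solve-∀ ℚ-ring
std-injective {zero} {[] ∷ [] ∷ _} ((≢ ∷ _) ∷ _) = contradiction refl ≢
std-injective {suc n} {B} u c vanish {j ∷ e} a∈ =
  -- Already `length B` levels cover all monomials. Padding by `suc j` puts j below the bound
  -- without an estimate; the added levels are empty.
  descend (suc j ℕ.+ length B) vanish' (ℕP.m≤m+n (suc j) (length B)) (∈-std⁻ B a∈)
  where
  open ≡-Reasoning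
  g : ℕ → Exp n → ℚ
  g j p = sum (λ i → c (j ∷ lookup (std (layer j B)) i) * ι (binomProd p (lookup (std (layer j B)) i)))

  -- The root count concerns only tails in layer j. Removing level j from the equations at all
  -- points of `B` also requires its term to vanish over tails with short fibres.
  g-zero : ∀ {j} → (∀ {e} → e ∈ std (layer j B) → c (j ∷ e) ≡ 0ℚ) → ∀ p → g j p ≡ 0ℚ
  g-zero {j} z p = trans
    (QS.sum-cong-≗ (λ i → trans (cong (_* ι (binomProd p (lookup (std (layer j B)) i))) (z (∈-lookup {xs = std (layer j B)} i))) (QP.*-zeroˡ (ι (binomProd p (lookup (std (layer j B)) i))))))
    (QS.sum-replicate-zero (length (std (layer j B))))

  vanish' : ∀ {x p} → (x ∷ p) ∈ B → sumTo (suc j ℕ.+ length B) (λ j → ι (x C j) * g j p) ≡ 0ℚ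
  vanish' {x} {p} b∈ = begin
    sumTo J (λ j → ι (x C j) * g j p)
      ≡⟨ sumTo-cong J (λ j → QS.*-distribˡ-sum (ι (x C j)) (λ i → c (j ∷ E j i) * ι (binomProd p (E j i)))) ⟩
    sumTo J (λ j → sum (λ i → ι (x C j) * (c (j ∷ E j i) * ι (binomProd p (E j i)))))
      ≡⟨ sumTo-cong J (λ j → QS.sum-cong-≗ (λ i → trans (lem (ι (x C j)) (c (j ∷ E j i)) _)
           (cong (c (j ∷ E j i) *_) (sym (ι-* (x C j) (binomProd p (E j i))))))) ⟩
    sumTo J (λ j → sum (λ i → φ (j ∷ E j i)))
      ≡⟨ sum-std B φ (ℕP.m≤n+m (length B) (suc j)) ⟨
    sum (φ ∘ lookup (std B))
      ≡⟨ vanish b∈ ⟩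
    0ℚ ∎
    where
    J = suc j ℕ.+ length B
    E : ∀ j → Fin (length (std (layer j B))) → Exp n
    E j = lookup (std (layer j B))
    φ : Exp (suc n) → ℚ
    φ a = c a * ι (binomProd (x ∷ p) a)
    lem : ∀ u v w → u * (v * w) ≡ v * (u * w)
    lem = solve-∀ ℚ-ring

  Vanishes : ℕ → Set
  Vanishes J = ∀ {x p} → (x ∷ p) ∈ B → sumTo J (λ j → ι (x C j) * g j p) ≡ 0ℚ

  -- The fibre over p ∈ layer J has more than J points, while the restriction
  -- to it has degree at most J: hence its top coefficient vanishes.
  top : ∀ J → Vanishes (suc J) → ∀ {e} → e ∈ std (layer J B) → c (J ∷ e) ≡ 0ℚ
  top J v = std-injective (layer-unique J B) (λ e → c (J ∷ e))
    (λ {p} p∈ → topCoefficient-zero J (λ j → g j p) (fibre-unique p u) (∈-layer⁻ B p∈)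
      (All.tabulate (λ x∈ → v (∈-fibre⁻ x∈))))

  descend : ∀ J → Vanishes J → ∀ {j e} → j < J → e ∈ std (layer j B) → c (j ∷ e) ≡ 0ℚ
  descend (suc J) v {j} j<1+J e∈ with ℕP.m≤n⇒m<n∨m≡n (s≤s⁻¹ j<1+J)
  ... | inj₂ refl = top J v e∈
  ... | inj₁ j<J = descend J v' j<J e∈
    where
    v' : Vanishes J
    v' {x} {p} b∈ = begin
      sumTo J φ                         ≡⟨ lem (sumTo J φ) (ι (x C J)) ⟩
      sumTo J φ + ι (x C J) * 0ℚ        ≡⟨ cong (λ t → sumTo J φ + ι (x C J) * t) (g-zero (top J v) p) ⟨
      sumTo J φ + ι (x C J) * g J p     ≡⟨ v b∈ ⟩
      0ℚ ∎
      where
      φ = λ j → ι (x C j) * g j p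
      lem : ∀ s t → s ≡ s + t * 0ℚ
      lem = solve-∀ ℚ-ring

-- The ring ℚ[t]

-- _≈P_ as a record, so that its arguments can be inferred.
infix 4 _≋_
record _≋_ (p q : QPoly) : Set where
  constructor coeffwise
  field at : p ≈P q
open _≋_

≋-refl : ∀ {p} → p ≋ p
≋-refl = coeffwise λ _ → refl

≋-sym : ∀ {p q} → p ≋ q → q ≋ p
≋-sym e = coeffwise (sym ∘ at e)

≋-trans : ∀ {p q r} → p ≋ q → q ≋ r → p ≋ r
≋-trans e e' = coeffwise λ i → trans (at e i) (at e' i)

≋-setoid : Setoid 0ℓ 0ℓ
≋-setoid = record
  { Carrier = QPoly ; _≈_ = _≋_
  ; isEquivalence = record { refl = ≋-refl ; sym = ≋-sym ; trans = ≋-trans } }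

-P_ : QPoly → QPoly
-P p = L.map (Q.-_) p

coeffAt-+ : ∀ p q i → coeffAt (p +P q) i ≡ coeffAt p i + coeffAt q i
coeffAt-+ []      q       i       = sym (QP.+-identityˡ (coeffAt q i))
coeffAt-+ (a ∷ p) []      i       = sym (QP.+-identityʳ (coeffAt (a ∷ p) i))
coeffAt-+ (a ∷ p) (b ∷ q) zero    = refl
coeffAt-+ (a ∷ p) (b ∷ q) (suc i) = coeffAt-+ p q i

coeffAt-scale : ∀ c p i → coeffAt (scaleP c p) i ≡ c * coeffAt p i
coeffAt-scale c []      i       = sym (QP.*-zeroʳ c)
coeffAt-scale c (a ∷ p) zero    = refl
coeffAt-scale c (a ∷ p) (suc i) = coeffAt-scale c p i

coeffAt-neg : ∀ p i → coeffAt (-P p) i ≡ Q.- coeffAt p i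
coeffAt-neg []      i       = refl
coeffAt-neg (a ∷ p) zero    = refl
coeffAt-neg (a ∷ p) (suc i) = coeffAt-neg p i

+P-cong : ∀ {p p' q q'} → p ≋ p' → q ≋ q' → p +P q ≋ p' +P q'
+P-cong {p} {p'} {q} {q'} e e' = coeffwise λ i →
  trans (coeffAt-+ p q i) (trans (cong₂ _+_ (at e i) (at e' i)) (sym (coeffAt-+ p' q' i)))

+P-comm : ∀ p q → p +P q ≋ q +P p
+P-comm p q = coeffwise λ i → trans (coeffAt-+ p q i) (trans (QP.+-comm (coeffAt p i) (coeffAt q i)) (sym (coeffAt-+ q p i)))

+P-assoc : ∀ p q r → (p +P q) +P r ≋ p +P (q +P r)
+P-assoc p q r = coeffwise λ i → begin
  coeffAt ((p +P q) +P r) i                   ≡⟨ coeffAt-+ (p +P q) r i ⟩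
  coeffAt (p +P q) i + coeffAt r i            ≡⟨ cong (_+ coeffAt r i) (coeffAt-+ p q i) ⟩
  coeffAt p i + coeffAt q i + coeffAt r i     ≡⟨ QP.+-assoc (coeffAt p i) (coeffAt q i) (coeffAt r i) ⟩
  coeffAt p i + (coeffAt q i + coeffAt r i)   ≡⟨ cong (coeffAt p i +_) (coeffAt-+ q r i) ⟨
  coeffAt p i + coeffAt (q +P r) i            ≡⟨ coeffAt-+ p (q +P r) i ⟨
  coeffAt (p +P (q +P r)) i                   ∎
  where open ≡-Reasoning

+P-identityʳ : ∀ p → p +P [] ≋ p
+P-identityʳ p = +P-comm p []

-P-inverseʳ : ∀ p → p +P (-P p) ≋ []
-P-inverseʳ p = coeffwise λ i → trans (coeffAt-+ p (-P p) i)
  (trans (cong (coeffAt p i +_) (coeffAt-neg p i)) (QP.+-inverseʳ (coeffAt p i)))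

-P-cong : ∀ {p q} → p ≋ q → -P p ≋ -P q
-P-cong {p} {q} e = coeffwise λ i → trans (coeffAt-neg p i) (trans (cong (Q.-_) (at e i)) (sym (coeffAt-neg q i)))

scale-cong : ∀ a {p q} → p ≋ q → scaleP a p ≋ scaleP a q
scale-cong a {p} {q} e = coeffwise λ i →
  trans (coeffAt-scale a p i) (trans (cong (a *_) (at e i)) (sym (coeffAt-scale a q i)))

scale-+ : ∀ c p q → scaleP c (p +P q) ≋ scaleP c p +P scaleP c q
scale-+ c p q = coeffwise λ i → begin
  coeffAt (scaleP c (p +P q)) i                      ≡⟨ coeffAt-scale c (p +P q) i ⟩
  c * coeffAt (p +P q) i                             ≡⟨ cong (c *_) (coeffAt-+ p q i) ⟩
  c * (coeffAt p i + coeffAt q i)                    ≡⟨ QP.*-distribˡ-+ c (coeffAt p i) (coeffAt q i) ⟩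
  c * coeffAt p i + c * coeffAt q i                  ≡⟨ cong₂ _+_ (coeffAt-scale c p i) (coeffAt-scale c q i) ⟨
  coeffAt (scaleP c p) i + coeffAt (scaleP c q) i    ≡⟨ coeffAt-+ (scaleP c p) (scaleP c q) i ⟨
  coeffAt (scaleP c p +P scaleP c q) i               ∎
  where open ≡-Reasoning

+-scale : ∀ a b p → scaleP (a + b) p ≋ scaleP a p +P scaleP b p
+-scale a b p = coeffwise λ i → begin
  coeffAt (scaleP (a + b) p) i                       ≡⟨ coeffAt-scale (a + b) p i ⟩
  (a + b) * coeffAt p i                              ≡⟨ QP.*-distribʳ-+ (coeffAt p i) a b ⟩
  a * coeffAt p i + b * coeffAt p i                  ≡⟨ cong₂ _+_ (coeffAt-scale a p i) (coeffAt-scale b p i) ⟨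
  coeffAt (scaleP a p) i + coeffAt (scaleP b p) i    ≡⟨ coeffAt-+ (scaleP a p) (scaleP b p) i ⟨
  coeffAt (scaleP a p +P scaleP b p) i               ∎
  where open ≡-Reasoning

scale-scale : ∀ a b p → scaleP (a * b) p ≋ scaleP a (scaleP b p)
scale-scale a b p = coeffwise λ i → begin
  coeffAt (scaleP (a * b) p) i        ≡⟨ coeffAt-scale (a * b) p i ⟩
  a * b * coeffAt p i                 ≡⟨ QP.*-assoc a b (coeffAt p i) ⟩
  a * (b * coeffAt p i)               ≡⟨ cong (a *_) (coeffAt-scale b p i) ⟨
  a * coeffAt (scaleP b p) i          ≡⟨ coeffAt-scale a (scaleP b p) i ⟨
  coeffAt (scaleP a (scaleP b p)) i   ∎
  where open ≡-Reasoning

scale-1 : ∀ p → scaleP 1ℚ p ≋ p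
scale-1 p = coeffwise λ i → trans (coeffAt-scale 1ℚ p i) (QP.*-identityˡ (coeffAt p i))

scale-0 : ∀ p → scaleP 0ℚ p ≋ []
scale-0 p = coeffwise λ i → trans (coeffAt-scale 0ℚ p i) (QP.*-zeroˡ (coeffAt p i))

∷-cong : ∀ {a b p q} → a ≡ b → p ≋ q → a ∷ p ≋ b ∷ q
∷-cong e e' = coeffwise λ { zero → e ; (suc i) → at e' i }

0∷[]≋[] : 0ℚ ∷ [] ≋ []
0∷[]≋[] = coeffwise λ { zero → refl ; (suc i) → refl }

shift-+ : ∀ p q → 0ℚ ∷ (p +P q) ≋ (0ℚ ∷ p) +P (0ℚ ∷ q)
shift-+ p q = ∷-cong (sym (QP.+-identityˡ 0ℚ)) ≋-refl

shift-scale : ∀ c p → scaleP c (0ℚ ∷ p) ≋ 0ℚ ∷ scaleP c p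
shift-scale c p = ∷-cong (QP.*-zeroʳ c) ≋-refl

+P-interchange : ∀ p q r s → (p +P q) +P (r +P s) ≋ (p +P r) +P (q +P s)
+P-interchange p q r s = coeffwise λ i → begin
  coeffAt ((p +P q) +P (r +P s)) i   ≡⟨ split p q r s i ⟩
  coeffAt p i + coeffAt q i + (coeffAt r i + coeffAt s i) ≡⟨ lem (coeffAt p i) (coeffAt q i) (coeffAt r i) (coeffAt s i) ⟩
  coeffAt p i + coeffAt r i + (coeffAt q i + coeffAt s i) ≡⟨ split p r q s i ⟨
  coeffAt ((p +P r) +P (q +P s)) i   ∎
  where
  open ≡-Reasoning
  split : ∀ p q r s i → coeffAt ((p +P q) +P (r +P s)) i ≡ coeffAt p i + coeffAt q i + (coeffAt r i + coeffAt s i)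
  split p q r s i = trans (coeffAt-+ (p +P q) (r +P s) i) (cong₂ _+_ (coeffAt-+ p q i) (coeffAt-+ r s i))
  lem : ∀ a b c d → a + b + (c + d) ≡ a + c + (b + d)
  lem = solve-∀ ℚ-ring

*P-congˡ : ∀ p {q q'} → q ≋ q' → p *P q ≋ p *P q'
*P-congˡ []      e = ≋-refl
*P-congˡ (a ∷ p) e = +P-cong (scale-cong a e) (∷-cong refl (*P-congˡ p e))

*P-zeroʳ : ∀ p → p *P [] ≋ []
*P-zeroʳ []      = ≋-refl
*P-zeroʳ (a ∷ p) = ≋-trans (∷-cong refl (*P-zeroʳ p)) 0∷[]≋[]

*P-∷ : ∀ p b q → p *P (b ∷ q) ≋ scaleP b p +P (0ℚ ∷ (p *P q))
*P-∷ []      b q = ≋-sym 0∷[]≋[]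
*P-∷ (a ∷ p) b q = ∷-cong (cong (_+ 0ℚ) (QP.*-comm a b)) (begin
  scaleP a q +P (p *P (b ∷ q))                     ≈⟨ +P-cong ≋-refl (*P-∷ p b q) ⟩
  scaleP a q +P (scaleP b p +P (0ℚ ∷ (p *P q)))    ≈⟨ +P-assoc (scaleP a q) (scaleP b p) _ ⟨
  (scaleP a q +P scaleP b p) +P (0ℚ ∷ (p *P q))    ≈⟨ +P-cong (+P-comm (scaleP a q) (scaleP b p)) ≋-refl ⟩
  (scaleP b p +P scaleP a q) +P (0ℚ ∷ (p *P q))    ≈⟨ +P-assoc (scaleP b p) (scaleP a q) _ ⟩
  scaleP b p +P ((a ∷ p) *P q)                     ∎)
  where open import Relation.Binary.Reasoning.Setoid ≋-setoid

*P-comm : ∀ p q → p *P q ≋ q *P p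
*P-comm []      q = ≋-sym (*P-zeroʳ q)
*P-comm (a ∷ p) q = ≋-trans (+P-cong ≋-refl (∷-cong refl (*P-comm p q))) (≋-sym (*P-∷ q a p))

*P-cong : ∀ {p p' q q'} → p ≋ p' → q ≋ q' → p *P q ≋ p' *P q'
*P-cong {p} {p'} {q} {q'} e e' = ≋-trans (*P-congˡ p e')
  (≋-trans (*P-comm p q') (≋-trans (*P-congˡ q' e) (*P-comm q' p')))

*P-distribʳ : ∀ r p q → (p +P q) *P r ≋ (p *P r) +P (q *P r)
*P-distribʳ r []      q       = ≋-refl
*P-distribʳ r (a ∷ p) []      = ≋-sym (+P-identityʳ ((a ∷ p) *P r))
*P-distribʳ r (a ∷ p) (b ∷ q) = ≋-trans
  (+P-cong (+-scale a b r) (≋-trans (∷-cong refl (*P-distribʳ r p q)) (shift-+ (p *P r) (q *P r))))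
  (+P-interchange (scaleP a r) (scaleP b r) (0ℚ ∷ (p *P r)) (0ℚ ∷ (q *P r)))

scale-*P : ∀ c p q → scaleP c p *P q ≋ scaleP c (p *P q)
scale-*P c []      q = ≋-refl
scale-*P c (a ∷ p) q = ≋-trans
  (+P-cong (scale-scale c a q) (≋-trans (∷-cong refl (scale-*P c p q)) (≋-sym (shift-scale c (p *P q)))))
  (≋-sym (scale-+ c (scaleP a q) (0ℚ ∷ (p *P q))))

shift-*P : ∀ p q → (0ℚ ∷ p) *P q ≋ 0ℚ ∷ (p *P q)
shift-*P p q = +P-cong (scale-0 q) ≋-refl

*P-assoc : ∀ p q r → (p *P q) *P r ≋ p *P (q *P r)
*P-assoc []      q r = ≋-refl
*P-assoc (a ∷ p) q r = ≋-trans (*P-distribʳ r (scaleP a q) (0ℚ ∷ (p *P q)))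
  (+P-cong (scale-*P a q r) (≋-trans (shift-*P (p *P q) r) (∷-cong refl (*P-assoc p q r))))

*P-identityˡ : ∀ p → (1ℚ ∷ []) *P p ≋ p
*P-identityˡ p = ≋-trans (+P-cong (scale-1 p) 0∷[]≋[]) (+P-identityʳ p)

QPoly-commutativeRing : CommutativeRing 0ℓ 0ℓ
QPoly-commutativeRing = record
  { Carrier = QPoly ; _≈_ = _≋_ ; _+_ = _+P_ ; _*_ = _*P_ ; -_ = -P_ ; 0# = [] ; 1# = 1ℚ ∷ []
  ; isCommutativeRing = record
    { isRing = record
      { +-isAbelianGroup = record
        { isGroup = record
          { isMonoid = record
            { isSemigroup = record
              { isMagma = record
                { isEquivalence = Setoid.isEquivalence ≋-setoid
                ; ∙-cong = +P-cong }
              ; assoc = +P-assoc }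
            ; identity = (λ _ → ≋-refl) , +P-identityʳ }
          ; inverse = (λ p → ≋-trans (+P-comm (-P p) p) (-P-inverseʳ p)) , -P-inverseʳ
          ; ⁻¹-cong = -P-cong }
        ; comm = +P-comm }
      ; *-cong = *P-cong
      ; *-assoc = *P-assoc
      ; *-identity = *P-identityˡ , (λ p → ≋-trans (*P-comm p (1ℚ ∷ [])) (*P-identityˡ p))
      ; distrib = (λ r p q → ≋-trans (*P-comm r (p +P q)) (≋-trans (*P-distribʳ r p q) (+P-cong (*P-comm p r) (*P-comm q r))))
                , *P-distribʳ }
    ; *-comm = *P-comm } }

module R = CommutativeRing QPoly-commutativeRing

isZero⇒≋[] : ∀ {p} → IsZeroP p → p ≋ []
isZero⇒≋[] []         = ≋-refl
isZero⇒≋[] (refl ∷ z) = ≋-trans (∷-cong refl (isZero⇒≋[] z)) 0∷[]≋[]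

≋[]⇒isZero : ∀ p → p ≋ [] → IsZeroP p
≋[]⇒isZero []      _ = []
≋[]⇒isZero (a ∷ p) e = at e 0 ∷ ≋[]⇒isZero p (coeffwise (at e ∘ suc))

_≋[]? : ∀ p → Dec (p ≋ [])
p ≋[]? = map′ isZero⇒≋[] (≋[]⇒isZero p) (All.all? (Q._≟ 0ℚ) p)

QPoly-ring : AlmostCommutativeRing 0ℓ 0ℓ
QPoly-ring = fromCommutativeRing QPoly-commutativeRing (λ p → dec⇒maybe (map′ ≋-sym ≋-sym (p ≋[]?)))

shift-≋[] : ∀ {p} → 0ℚ ∷ p ≋ [] → p ≋ []
shift-≋[] e = coeffwise (at e ∘ suc)

-- Factors t are stripped from `q` until its constant term is nonzero; then the coefficients of `p`
-- vanish from the lowest up. Working from the low end suits lists that may end in zeros.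
*P-integral : ∀ p q → p *P q ≋ [] → ¬ q ≋ [] → p ≋ []
*P-integral p []      _ q≉0 = contradiction ≋-refl q≉0
*P-integral p (b ∷ q) e q≉0 with b Q.≟ 0ℚ
... | yes refl = *P-integral p q (shift-≋[] (begin
    0ℚ ∷ (p *P q)                      ≈⟨ +P-cong (scale-0 p) ≋-refl ⟨
    scaleP 0ℚ p +P (0ℚ ∷ (p *P q))     ≈⟨ *P-∷ p 0ℚ q ⟨
    p *P (0ℚ ∷ q)                      ≈⟨ e ⟩
    []                                 ∎))
    (λ z → q≉0 (≋-trans (∷-cong refl z) 0∷[]≋[]))
  where open import Relation.Binary.Reasoning.Setoid R.setoid
... | no b≢0 = go p e
  where
  go : ∀ p → p *P (b ∷ q) ≋ [] → p ≋ []
  go []      _ = ≋-refl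
  go (a ∷ p) e = ≋-trans (∷-cong a≡0 (go p (shift-≋[] (≋-trans (≋-sym (shift-*P p (b ∷ q)))
      (≋-trans (*P-cong {0ℚ ∷ p} {a ∷ p} {b ∷ q} (∷-cong (sym a≡0) ≋-refl) ≋-refl) e))))) 0∷[]≋[]
    where
    a≡0 : a ≡ 0ℚ
    a≡0 = *-integral b (trans (QP.*-comm b a) (trans (sym (QP.+-identityʳ (a * b))) (at e 0))) b≢0

monoT-cong : ∀ {a b} → a ≡ b → ∀ i → monoT a i ≋ monoT b i
monoT-cong refl i = ≋-refl

monoT-0 : ∀ i → monoT 0ℚ i ≋ []
monoT-0 zero    = 0∷[]≋[]
monoT-0 (suc i) = ≋-trans (∷-cong refl (monoT-0 i)) 0∷[]≋[]

monoT-* : ∀ a i b j → monoT a i *P monoT b j ≋ monoT (a * b) (i ℕ.+ j)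
monoT-* a (suc i) b j = ≋-trans (shift-*P (monoT a i) (monoT b j)) (∷-cong refl (monoT-* a i b j))
monoT-* a zero    b j = ≋-trans (+P-cong ≋-refl 0∷[]≋[]) (≋-trans (+P-identityʳ (scaleP a (monoT b j))) (scale-mono j))
  where
  scale-mono : ∀ j → scaleP a (monoT b j) ≋ monoT (a * b) j
  scale-mono zero    = ≋-refl
  scale-mono (suc j) = ≋-trans (shift-scale a (monoT b j)) (∷-cong refl (scale-mono j))

monoT-1≉0 : ∀ i → ¬ monoT 1ℚ i ≋ []
monoT-1≉0 zero    e = contradiction (at e 0) λ ()
monoT-1≉0 (suc i) e = monoT-1≉0 i (shift-≋[] e)

coeffAt-*-0 : ∀ p q → coeffAt (p *P q) 0 ≡ coeffAt p 0 * coeffAt q 0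
coeffAt-*-0 []      q = sym (QP.*-zeroˡ (coeffAt q 0))
coeffAt-*-0 (a ∷ p) q = trans (coeffAt-+ (scaleP a q) (0ℚ ∷ (p *P q)) 0)
  (trans (QP.+-identityʳ (coeffAt (scaleP a q) 0)) (coeffAt-scale a q 0))

-- Linear algebra over ℚ[t] and ℚ(t)

open import Algebra.Properties.Semiring.Sum R.semiring as PS using () renaming (sum to sumP)
open import Algebra.Properties.Group R.+-group using () renaming (x∙y⁻¹≈ε⇒x≈y to p-q≋0⇒p≋q)
open import Relation.Binary.Reasoning.Setoid R.setoid

module _ (M : CommutativeMonoid 0ℓ 0ℓ) where
  private module M = CommutativeMonoid M
  open M using (Carrier; _≈_; _∙_)
  open import Algebra.Properties.CommutativeMonoid.Sum M using () renaming (sum to sumM; sum-cong-≋ to sumM-cong)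

  -- The general monoid serves two uses: adding one term of `f` in ℚ[t], and isolating the one
  -- surviving constant term in ℚ.
  sum-update : ∀ {A : Set} {φ ψ : A → Carrier} y {x xs} → Unique xs → x ∈ xs →
    ψ x ≈ y ∙ φ x → (∀ {x'} → x ≢ x' → ψ x' ≈ φ x') →
    sumM (ψ ∘ lookup xs) ≈ y ∙ sumM (φ ∘ lookup xs)
  sum-update {φ = φ} {ψ} y {x} {_ ∷ xs} (x∉ ∷ _) (here refl) eq eq' =
    M.trans (M.∙-cong eq (sumM-cong λ i → eq' (All.lookup x∉ (∈-lookup {xs = xs} i)))) (M.assoc _ _ _)
  sum-update {φ = φ} {ψ} y {x} {x' ∷ xs} (x'∉ ∷ u) (there x∈) eq eq' =
    M.trans (M.∙-cong (eq' (All.lookup x'∉ x∈ ∘ sym)) (sum-update y u x∈ eq eq'))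
      (M.trans (M.sym (M.assoc _ _ _)) (M.trans (M.∙-congʳ (M.comm _ _)) (M.assoc _ _ _)))

sumP-zero : ∀ {r} {x : Fin r → QPoly} → (∀ j → x j ≋ []) → sumP x ≋ []
sumP-zero {r} z = ≋-trans (PS.sum-cong-≋ z) (PS.sum-replicate-zero r)

pivot-sum : ∀ {m} (x z : Fin m → QPoly) y →
  ((-P sumP x) *P y) +P sumP z ≋ sumP (λ j → z j +P (-P (x j *P y)))
pivot-sum {zero}  x z y = ≋-refl
pivot-sum {suc m} x z y = ≋-trans (lem (x zero) (sumP (x ∘ suc)) y (z zero) (sumP (z ∘ suc)))
  (+P-cong ≋-refl (pivot-sum (x ∘ suc) (z ∘ suc) y))
  where
  lem : ∀ x s y z t → ((-P (x +P s)) *P y) +P (z +P t) ≋ (z +P (-P (x *P y))) +P (((-P s) *P y) +P t)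
  lem = solve-∀ QPoly-ring

-- Gaussian elimination without division: `w j` combines `v' j` with the pivot vector so that the
-- first coordinate cancels. A relation among the `w j` expands to one among the `v j`, nontrivial
-- because its coefficients are multiplied by the pivot entry in a domain.
linearRelation : ∀ {m r} → r < m → (v : Fin m → Fin r → QPoly) →
  Σ (Fin m → QPoly) λ α → (∃ λ j → ¬ α j ≋ []) × (∀ b → sumP (λ j → α j *P v j b) ≋ [])
linearRelation {suc m} {zero} _ v = (λ _ → 1ℚ ∷ []) , (zero , monoT-1≉0 0) , λ ()
linearRelation {suc m} {suc r} r<m v with any? (λ j → ¬? (v j zero ≋[]?))
... | no none = α , nz , eq'
  where
  rel = linearRelation (ℕP.<⇒≤ r<m) (λ j b → v j (suc b))
  α = proj₁ rel
  nz = proj₁ (proj₂ rel)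
  eq' : ∀ b → sumP (λ j → α j *P v j b) ≋ []
  eq' (suc b) = proj₂ (proj₂ rel) b
  eq' zero    = sumP-zero λ j → ≋-trans
    (*P-congˡ (α j) (decidable-stable (v j zero ≋[]?) (λ nz → none (j , nz)))) (*P-zeroʳ (α j))
... | yes (p , π≉0) = α , (punchIn p j₀ , α≉0) , eq'
  where
  π = v p zero
  v' : Fin m → Fin (suc r) → QPoly
  v' j = v (punchIn p j)
  w : Fin m → Fin (suc r) → QPoly
  w j b = (π *P v' j b) +P (-P (v' j zero *P v p b))
  rel = linearRelation (s≤s⁻¹ r<m) (λ j b → w j (suc b))
  β = proj₁ rel
  j₀ = proj₁ (proj₁ (proj₂ rel))
  β≉0 = proj₂ (proj₁ (proj₂ rel))
  αp = -P sumP (λ j → β j *P v' j zero)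
  α : Fin (suc m) → QPoly
  α = insertAt (λ j → π *P β j) p αp
  α≉0 : ¬ α (punchIn p j₀) ≋ []
  α≉0 z = π≉0 (*P-integral π (β j₀)
    (subst (_≋ []) (insertAt-punchIn (λ j → π *P β j) p αp j₀) z) β≉0)
  w-relation : ∀ b → sumP (λ j → β j *P w j b) ≋ []
  w-relation (suc b) = proj₂ (proj₂ rel) b
  w-relation zero    = sumP-zero λ j → lem (β j) π (v' j zero)
    where
    lem : ∀ β π x → β *P ((π *P x) +P (-P (x *P π))) ≋ []
    lem = solve-∀ QPoly-ring
  eq' : ∀ b → sumP (λ j → α j *P v j b) ≋ []
  eq' b = begin
    sumP (λ j → α j *P v j b)
      ≈⟨ PS.sum-remove {i = p} (λ j → α j *P v j b) ⟩
    (α p *P v p b) +P sumP (λ j → α (punchIn p j) *P v' j b)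
      ≈⟨ +P-cong (R.reflexive (cong (_*P v p b) (insertAt-lookup (λ j → π *P β j) p αp)))
           (PS.sum-cong-≋ λ j → R.reflexive (cong (_*P v' j b) (insertAt-punchIn (λ j → π *P β j) p αp j))) ⟩
    (αp *P v p b) +P sumP (λ j → (π *P β j) *P v' j b)
      ≈⟨ pivot-sum (λ j → β j *P v' j zero) (λ j → (π *P β j) *P v' j b) (v p b) ⟩
    sumP (λ j → ((π *P β j) *P v' j b) +P (-P ((β j *P v' j zero) *P v p b)))
      ≈⟨ PS.sum-cong-≋ (λ j → lem π (β j) (v' j b) (v' j zero) (v p b)) ⟩
    sumP (λ j → β j *P w j b)
      ≈⟨ w-relation b ⟩
    [] ∎
    where
    lem : ∀ π β x y z → ((π *P β) *P x) +P (-P ((β *P y) *P z)) ≋ β *P ((π *P x) +P (-P (y *P z)))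
    lem = solve-∀ QPoly-ring

coeffAt-sum : ∀ {r} (p : Fin r → QPoly) i → coeffAt (sumP p) i ≡ sum (λ j → coeffAt (p j) i)
coeffAt-sum {zero}  p i = refl
coeffAt-sum {suc r} p i = trans (coeffAt-+ (p zero) (sumP (p ∘ suc)) i)
  (cong (coeffAt (p zero) i +_) (coeffAt-sum (p ∘ suc) i))

-- If the matrix is injective at t = 0, then the coefficients of a relation
-- vanish one power of t after the other.
injectiveAt0⇒injective : ∀ {r s} (N : Fin r → Fin s → QPoly) →
  (∀ c → (∀ b → sum (λ a → c a * coeffAt (N a b) 0) ≡ 0ℚ) → ∀ a → c a ≡ 0ℚ) →
  ∀ γ → (∀ b → sumP (λ a → γ a *P N a b) ≋ []) → ∀ a → γ a ≋ []
injectiveAt0⇒injective {r} {s} N inj₀ γ rel a = coeffwise λ i → coefficients i γ rel a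
  where
  constants : ∀ γ → (∀ b → sumP (λ a → γ a *P N a b) ≋ []) → ∀ a → coeffAt (γ a) 0 ≡ 0ℚ
  constants γ rel = inj₀ (λ a → coeffAt (γ a) 0) λ b → trans
    (QS.sum-cong-≗ λ a → sym (coeffAt-*-0 (γ a) (N a b)))
    (trans (sym (coeffAt-sum (λ a → γ a *P N a b) 0)) (at (rel b) 0))
  tail : QPoly → QPoly
  tail = L.drop 1
  ≋-tail : ∀ p → coeffAt p 0 ≡ 0ℚ → p ≋ 0ℚ ∷ tail p
  ≋-tail []      _ = ≋-sym 0∷[]≋[]
  ≋-tail (_ ∷ p) e = ∷-cong e ≋-refl
  shift-sum : ∀ {m} (x : Fin m → QPoly) → sumP (λ j → 0ℚ ∷ x j) ≋ 0ℚ ∷ sumP x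
  shift-sum {zero}  x = ≋-sym 0∷[]≋[]
  shift-sum {suc m} x = ≋-trans (+P-cong ≋-refl (shift-sum (x ∘ suc))) (≋-sym (shift-+ (x zero) (sumP (x ∘ suc))))
  coefficients : ∀ i γ → (∀ b → sumP (λ a → γ a *P N a b) ≋ []) → ∀ a → coeffAt (γ a) i ≡ 0ℚ
  coefficients zero    γ rel   = constants γ rel
  coefficients (suc i) γ rel a = trans (at (≋-tail (γ a) (constants γ rel a)) (suc i))
    (coefficients i (tail ∘ γ) (λ b → shift-≋[] (begin
      0ℚ ∷ sumP (λ a → tail (γ a) *P N a b)     ≈⟨ shift-sum (λ a → tail (γ a) *P N a b) ⟨
      sumP (λ a → 0ℚ ∷ (tail (γ a) *P N a b))   ≈⟨ PS.sum-cong-≋ (λ a → shift-*P (tail (γ a)) (N a b)) ⟨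
      sumP (λ a → (0ℚ ∷ tail (γ a)) *P N a b)   ≈⟨ PS.sum-cong-≋ (λ a → *P-cong (≋-tail (γ a) (constants γ rel a)) ≋-refl) ⟨
      sumP (λ a → γ a *P N a b)                 ≈⟨ rel b ⟩
      []                                        ∎)) a)

-- Passing between ℚ(t) and ℚ[t]

denProduct : ∀ {r} → (Fin r → RatFun) → QPoly
denProduct {zero}  a = 1ℚ ∷ []
denProduct {suc r} a = den (a zero) *P denProduct (a ∘ suc)

den-lincombR : ∀ {r k} (a : Fin r → RatFun) (v : Fin r → PVec k) i → proj₂ (lincombR a v i) ≡ denProduct a
den-lincombR {zero}  a v i = refl
den-lincombR {suc r} a v i = cong (den (a zero) *P_) (den-lincombR (a ∘ suc) (v ∘ suc) i)

den≉0 : ∀ x → ¬ den x ≋ []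
den≉0 x z = den≢0 x (≋[]⇒isZero (den x) z)

denProduct≉0 : ∀ {r} (a : Fin r → RatFun) → ¬ denProduct a ≋ []
denProduct≉0 {zero}  a z = monoT-1≉0 0 z
denProduct≉0 {suc r} a z = den≉0 (a zero) (*P-integral _ _ z (denProduct≉0 (a ∘ suc)))

-- Here `β j` is the numerator of `a j` times all the other denominators. Their product is nonzero,
-- so a vanishing `β j` forces a vanishing numerator.
clearDenominators : ∀ {r} (a : Fin r → RatFun) → Σ (Fin r → QPoly) λ β →
  (∀ j → β j ≋ [] → num (a j) ≋ []) ×
  (∀ {k} (v : Fin r → PVec k) i → proj₁ (lincombR a v i) ≋ sumP (λ j → β j *P v j i))
clearDenominators {zero}  a = (λ ()) , (λ ()) , λ _ _ → ≋-refl
clearDenominators {suc r} a = β , β-zero , β-sum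
  where
  rest = clearDenominators (a ∘ suc)
  β : Fin (suc r) → QPoly
  β zero    = num (a zero) *P denProduct (a ∘ suc)
  β (suc j) = proj₁ rest j *P den (a zero)
  β-zero : ∀ j → β j ≋ [] → num (a j) ≋ []
  β-zero zero    z = *P-integral _ _ z (denProduct≉0 (a ∘ suc))
  β-zero (suc j) z = proj₁ (proj₂ rest) j (*P-integral _ _ z (den≉0 (a zero)))
  β-sum : ∀ {k} (v : Fin (suc r) → PVec k) i → proj₁ (lincombR a v i) ≋ sumP (λ j → β j *P v j i)
  β-sum v i = +P-cong
    (begin
      (num (a zero) *P v zero i) *P proj₂ (lincombR (a ∘ suc) (v ∘ suc) i)
        ≡⟨ cong ((num (a zero) *P v zero i) *P_) (den-lincombR (a ∘ suc) (v ∘ suc) i) ⟩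
      (num (a zero) *P v zero i) *P denProduct (a ∘ suc)
        ≈⟨ lem (num (a zero)) (v zero i) (denProduct (a ∘ suc)) ⟩
      β zero *P v zero i ∎)
    (begin
      proj₁ (lincombR (a ∘ suc) (v ∘ suc) i) *P d
        ≈⟨ *P-cong (proj₂ (proj₂ rest) (v ∘ suc) i) ≋-refl ⟩
      sumP (λ j → proj₁ rest j *P v (suc j) i) *P d
        ≈⟨ PS.*-distribʳ-sum d (λ j → proj₁ rest j *P v (suc j) i) ⟩
      sumP (λ j → (proj₁ rest j *P v (suc j) i) *P d)
        ≈⟨ PS.sum-cong-≋ (λ j → lem (proj₁ rest j) (v (suc j) i) d) ⟩
      sumP (λ j → β (suc j) *P v (suc j) i) ∎)
    where
    d = den (a zero)
    lem : ∀ x y z → (x *P y) *P z ≋ (x *P z) *P y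
    lem = solve-∀ QPoly-ring

-- `lincombR` never cancels, so its denominator is a power of δ; the cross-multiplied form avoids
-- handling that power.
lincombR-commonDen : ∀ {r k} (ν : Fin r → QPoly) δ δ≢0 (v : Fin r → PVec k) i →
  let l = lincombR (λ j → ν j ⟋ δ ∣ δ≢0) v i in
  δ *P proj₁ l ≋ proj₂ l *P sumP (λ j → ν j *P v j i)
lincombR-commonDen {zero}  ν δ δ≢0 v i = ≋-trans (*P-zeroʳ δ) (≋-sym (*P-zeroʳ (1ℚ ∷ [])))
lincombR-commonDen {suc r} ν δ δ≢0 v i = begin
  δ *P (((ν zero *P v zero i) *P q) +P (p *P δ))            ≈⟨ lem₁ δ (ν zero *P v zero i) q p ⟩
  ((δ *P q) *P (ν zero *P v zero i)) +P (δ *P (δ *P p))     ≈⟨ +P-cong ≋-refl (*P-congˡ δ (lincombR-commonDen (ν ∘ suc) δ δ≢0 (v ∘ suc) i)) ⟩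
  ((δ *P q) *P (ν zero *P v zero i)) +P (δ *P (q *P s))     ≈⟨ lem₂ δ q (ν zero *P v zero i) s ⟩
  (δ *P q) *P ((ν zero *P v zero i) +P s)                   ∎
  where
  l = lincombR (λ j → ν (suc j) ⟋ δ ∣ δ≢0) (v ∘ suc) i
  p = proj₁ l
  q = proj₂ l
  s = sumP (λ j → ν (suc j) *P v (suc j) i)
  lem₁ : ∀ δ x q p → δ *P ((x *P q) +P (p *P δ)) ≋ ((δ *P q) *P x) +P (δ *P (δ *P p))
  lem₁ = solve-∀ QPoly-ring
  lem₂ : ∀ δ q x s → ((δ *P q) *P x) +P (δ *P (q *P s)) ≋ (δ *P q) *P (x +P s)
  lem₂ = solve-∀ QPoly-ring

-- The coefficients of f(x + t^w)

lookup-injective : ∀ {A : Set} {xs : List A} → Unique xs → ∀ i j → lookup xs i ≡ lookup xs j → i ≡ j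
lookup-injective (x∉ ∷ u) zero    zero    _ = refl
lookup-injective (x∉ ∷ u) (suc i) (suc j) e = cong suc (lookup-injective u i j e)
lookup-injective {xs = _ ∷ xs} (x∉ ∷ u) zero    (suc j) e = contradiction e (All.lookup x∉ (∈-lookup {xs = xs} j))
lookup-injective {xs = _ ∷ xs} (x∉ ∷ u) (suc i) zero    e = contradiction (sym e) (All.lookup x∉ (∈-lookup {xs = xs} i))

-- `std-injective` recurses on coefficient functions over all exponents, whereas relations are
-- indexed by list positions; this connects the two.
extend : ∀ {A : List (Exp n)} → Unique A → (c : Fin (length A) → ℚ) →
  Σ (Exp n → ℚ) λ c' → ∀ i → c' (lookup A i) ≡ c i
extend {n} {A} u c = c' , c'-lookup
  where
  open import Data.List.Membership.DecPropositional (_≟E_ {n}) using (_∈?_)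
  c' : Exp n → ℚ
  c' e with e ∈? A
  ... | yes e∈ = c (Any.index e∈)
  ... | no _   = 0ℚ
  c'-lookup : ∀ i → c' (lookup A i) ≡ c i
  c'-lookup i with lookup A i ∈? A
  ... | yes e∈ = cong c (sym (lookup-injective u i (Any.index e∈) (lookup-index e∈)))
  ... | no e∉  = contradiction (∈-lookup {xs = A} i) e∉

bounded : ∀ {r} (g : Fin r → ℕ) → ∃ λ W → ∀ i → g i ≤ W
bounded {zero}  g = 0 , λ ()
bounded {suc r} g = g zero ℕ.+ W , λ { zero → ℕP.m≤m+n _ W ; (suc i) → ℕP.≤-trans (h i) (ℕP.m≤n+m W (g zero)) }
  where
  W = proj₁ (bounded (g ∘ suc))
  h = proj₂ (bounded (g ∘ suc))

lincomb≡sum : ∀ {r k} (c : Fin r → ℚ) (v : Fin r → QVec k) i → lincomb c v i ≡ sum (λ j → c j * v j i)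
lincomb≡sum {zero}  c v i = refl
lincomb≡sum {suc r} c v i = cong (c zero * v zero i +_) (lincomb≡sum (c ∘ suc) (v ∘ suc) i)

unit : ∀ {r} → Fin r → Fin r → ℚ
unit zero    zero    = 1ℚ
unit zero    (suc _) = 0ℚ
unit (suc _) zero    = 0ℚ
unit (suc i) (suc j) = unit i j

unit-diag : ∀ {r} (i : Fin r) → unit i i ≡ 1ℚ
unit-diag zero    = refl
unit-diag (suc i) = unit-diag i

unit-off : ∀ {r} (i j : Fin r) → i ≢ j → unit i j ≡ 0ℚ
unit-off zero    zero    i≢j = contradiction refl i≢j
unit-off zero    (suc _) _   = refl
unit-off (suc _) zero    _   = refl
unit-off (suc i) (suc j) i≢j = unit-off i j (i≢j ∘ cong suc)

lincomb-zero : ∀ {r k} (v : Fin r → QVec k) i → lincomb (λ _ → 0ℚ) v i ≡ 0ℚ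
lincomb-zero {zero}  v i = refl
lincomb-zero {suc r} v i = cong₂ _+_ (QP.*-zeroˡ (v zero i)) (lincomb-zero (v ∘ suc) i)

lincomb-unit : ∀ {r k} (j : Fin r) (v : Fin r → QVec k) i → lincomb (unit j) v i ≡ v j i
lincomb-unit zero v i = trans (cong₂ _+_ (QP.*-identityˡ (v zero i)) (lincomb-zero (v ∘ suc) i)) (QP.+-identityʳ (v zero i))
lincomb-unit (suc j) v i = trans (cong₂ _+_ (QP.*-zeroˡ (v zero i)) (lincomb-unit j (v ∘ suc) i)) (QP.+-identityˡ (v (suc j) i))

binomProd-⋠ : ∀ (m e : Exp n) → ¬ e ≼ m → binomProd m e ≡ 0
binomProd-⋠ []      []      e⋠m = contradiction [] e⋠m
binomProd-⋠ (x ∷ m) (y ∷ e) e⋠m with y ℕ.≤? x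
... | no y≰x  = cong (ℕ._* binomProd m e) (k>n⇒nCk≡0 (ℕP.≰⇒> y≰x))
... | yes y≤x = trans (cong ((x C y) ℕ.*_) (binomProd-⋠ m e (λ e≼m → e⋠m (y≤x ∷ e≼m)))) (ℕP.*-zeroʳ (x C y))

weight-∸ : ∀ (w : Vec ℕ n) {m e} → e ≼ m → weight w (V.zipWith _∸_ m e) ℕ.+ weight w e ≡ weight w m
weight-∸ []      []            = refl
weight-∸ (v ∷ w) {x ∷ m} {y ∷ e} (y≤x ∷ e≼m) = trans
  (lem v (x ∸ y) y (weight w (V.zipWith _∸_ m e)) (weight w e))
  (cong₂ (λ a b → v ℕ.* a ℕ.+ b) (ℕP.m∸n+n≡m y≤x) (weight-∸ w e≼m))
  where
  lem : ∀ v d y s t → v ℕ.* d ℕ.+ s ℕ.+ (v ℕ.* y ℕ.+ t) ≡ v ℕ.* (d ℕ.+ y) ℕ.+ (s ℕ.+ t)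
  lem = ℕRing.solve-∀

const-sum : ∀ {r} (x : Fin r → ℚ) → sum x ∷ [] ≋ sumP (λ j → x j ∷ [])
const-sum {zero}  x = 0∷[]≋[]
const-sum {suc r} x = +P-cong {x zero ∷ []} ≋-refl (const-sum (x ∘ suc))

module _ (w : Vec ℕ n) where

  -- When `e` is not below `m` the truncated exponent is meaningless, but the binomial factor is
  -- then 0, so one formula covers both cases.
  shiftMono : Exp n → Exp n → QPoly
  shiftMono e m = monoT (ι (binomProd m e)) (weight w (V.zipWith _∸_ m e))

  shiftCoef-∷ : ∀ (f : Poly n k) m c e i →
    shiftCoef w ((m , c) ∷ f) e i ≋ (shiftMono e m *P (c i ∷ [])) +P shiftCoef w f e i
  shiftCoef-∷ f m c e i with PW.decidable ℕ._≤?_ e m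
  ... | yes _ = +P-cong (begin
      monoT ((pos (binomProd m e) / 1) * c i) d   ≡⟨ cong₂ (λ x y → monoT (x * c i) y) (ι-def (binomProd m e)) (sym (ℕP.+-identityʳ d)) ⟩
      monoT (ι (binomProd m e) * c i) (d ℕ.+ 0)   ≈⟨ monoT-* (ι (binomProd m e)) d (c i) 0 ⟨
      shiftMono e m *P monoT (c i) 0              ∎) ≋-refl
    where
    d = weight w (V.zipWith _∸_ m e)
  ... | no e⋠m = ≋-sym (+P-cong {p' = []} (*P-cong {p' = []} (begin
      shiftMono e m                ≡⟨ cong (λ x → monoT x d) (trans (cong ι (binomProd-⋠ m e e⋠m)) (sym (ι-def 0))) ⟩
      monoT 0ℚ d                   ≈⟨ monoT-0 d ⟩
      []                           ∎) ≋-refl) ≋-refl)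
    where
    d = weight w (V.zipWith _∸_ m e)

  -- A `Poly` may repeat exponents. Merging them brings in the true coefficients `coef f`, of which
  -- the isolation hypothesis speaks.
  shiftCoef-collect : ∀ {S : List (Exp n)} → Unique S → (f : Poly n k) → All (λ t → proj₁ t ∈ S) f → ∀ e i →
    shiftCoef w f e i ≋ sumP (λ s → shiftMono e (lookup S s) *P (coef f (lookup S s) i ∷ []))
  shiftCoef-collect {S = S} u [] [] e i = ≋-sym (sumP-zero λ s →
    ≋-trans (*P-congˡ (shiftMono e (lookup S s)) 0∷[]≋[]) (*P-zeroʳ (shiftMono e (lookup S s))))
  shiftCoef-collect {S = S} u ((m , c) ∷ f) (m∈ ∷ ms) e i = begin
    shiftCoef w ((m , c) ∷ f) e i
      ≈⟨ shiftCoef-∷ f m c e i ⟩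
    y +P shiftCoef w f e i
      ≈⟨ +P-cong {y} ≋-refl (shiftCoef-collect u f ms e i) ⟩
    y +P sumP (λ s → shiftMono e (lookup S s) *P (coef f (lookup S s) i ∷ []))
      ≈⟨ sum-update R.+-commutativeMonoid {φ = φ f} {φ ((m , c) ∷ f)} y u m∈ same other ⟨
    sumP (λ s → shiftMono e (lookup S s) *P (coef ((m , c) ∷ f) (lookup S s) i ∷ [])) ∎
    where
    y = shiftMono e m *P (c i ∷ [])
    φ : Poly n _ → Exp n → QPoly
    φ f m' = shiftMono e m' *P (coef f m' i ∷ [])
    same : φ ((m , c) ∷ f) m ≋ y +P φ f m
    same with m ≟E m
    ... | yes _ = R.distribˡ (shiftMono e m) (c i ∷ []) (coef f m i ∷ [])
    ... | no m≢m = contradiction refl m≢m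
    other : ∀ {m'} → m ≢ m' → φ ((m , c) ∷ f) m' ≋ φ f m'
    other {m'} m≢m' with m ≟E m'
    ... | yes m≡m' = contradiction m≡m' m≢m'
    ... | no _ = ≋-refl

-- Notation: b# and a# enumerate the isolating basis B and A = std B, and s#
-- a finite set of exponents containing B and all exponents occurring in f.
-- Expanding the coefficients of f in the basis B gives
--   coef_e (f(x + t^w)) = Σ_b transfer e b · coef_b (f).
module ShiftedBasis {n k : ℕ} (f : Poly n k) (w : Vec ℕ n) (isolation : BasisIsolating w f) where
  B = proj₁ isolation
  indep = proj₁ (proj₂ isolation)
  distinct = proj₁ (proj₂ (proj₂ (proj₂ isolation)))
  isolating = proj₂ (proj₂ (proj₂ (proj₂ isolation)))

  open import Data.List.Membership.DecPropositional (_≟E_ {n}) using (_∈?_)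
  open import Data.List.Relation.Unary.Unique.DecPropositional.Properties (_≟E_ {n}) using (deduplicate-!)

  A = std B
  r = length B
  b# : Fin r → Exp n
  b# = lookup B

  B-unique : Unique B
  B-unique = subst Unique (tabulate-lookup B)
    (tabulate⁺ (λ {i} {j} e → distinct i j (cong (weight w) e)))

  S = L.deduplicate _≟E_ (L.map proj₁ f ++ B)
  S-unique : Unique S
  S-unique = deduplicate-! (L.map proj₁ f ++ B)
  f⊆S : All (λ t → proj₁ t ∈ S) f
  f⊆S = All.tabulate (λ t∈ → ∈-deduplicate⁺ _≟E_ (∈-++⁺ˡ (∈-map⁺ proj₁ t∈)))
  B⊆S : ∀ b → b# b ∈ S
  B⊆S b = ∈-deduplicate⁺ _≟E_ (∈-++⁺ʳ (L.map proj₁ f) (∈-lookup {xs = B} b))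
  s# : Fin (length S) → Exp n
  s# = lookup S

  -- The triangular form of isolation: apart from `m` itself, only basis monomials of weight
  -- strictly below that of `m` contribute. Members of `B` get unit vectors, and zero coefficients,
  -- on which the isolation condition is silent, get zero coordinates.
  coordinates : ∀ m → Σ (Fin r → ℚ) λ c →
    (∀ i → coef f m i ≡ lincomb c (coefsAt f B) i) ×
    (∀ j → m ≡ b# j → c j ≡ 1ℚ) ×
    (∀ j → m ≢ b# j → weight w m ≤ weight w (b# j) → c j ≡ 0ℚ)
  coordinates m with m ∈? B
  ... | yes m∈ = unit p
      , (λ i → trans (cong (λ m → coef f m i) (lookup-index m∈)) (sym (lincomb-unit p (coefsAt f B) i)))
      , (λ j e → trans (cong (unit p) (lookup-injective B-unique j p (trans (sym e) (lookup-index m∈)))) (unit-diag p))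
      , (λ j m≢ _ → unit-off p j (λ { refl → m≢ (lookup-index m∈) }))
    where p = Any.index m∈
  ... | no m∉ with FP.all? (λ i → coef f m i Q.≟ 0ℚ)
  ...   | yes z = (λ _ → 0ℚ)
      , (λ i → trans (z i) (sym (lincomb-zero (coefsAt f B) i)))
      , (λ { j refl → contradiction (∈-lookup {xs = B} j) m∉ })
      , λ _ _ _ → refl
  ...   | no nz with isolating m nz m∉
  ...     | c , c-zero , c-eq = c , c-eq
      , (λ { j refl → contradiction (∈-lookup {xs = B} j) m∉ })
      , λ j _ → c-zero j

  coord : Exp n → Fin r → ℚ
  coord m = proj₁ (coordinates m)

  transfer : Exp n → Fin r → QPoly
  transfer e b = sumP (λ s → shiftMono w e (s# s) *P (coord (s# s) b ∷ []))

  fB : Fin r → Fin k → QPoly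
  fB b i = coefsAt f B b i ∷ []

  shiftCoef≋transfer : ∀ e i → shiftCoef w f e i ≋ sumP (λ b → transfer e b *P fB b i)
  shiftCoef≋transfer e i = begin
    shiftCoef w f e i
      ≈⟨ shiftCoef-collect w S-unique f f⊆S e i ⟩
    sumP (λ s → φ s *P (coef f (s# s) i ∷ []))
      ≈⟨ PS.sum-cong-≋ (λ s → *P-congˡ (φ s) (≋-trans
           (R.reflexive (cong (_∷ []) (trans (proj₁ (proj₂ (coordinates (s# s))) i) (lincomb≡sum (coord (s# s)) (coefsAt f B) i))))
           (const-sum (λ b → coord (s# s) b * coefsAt f B b i)))) ⟩
    sumP (λ s → φ s *P sumP (λ b → (coord (s# s) b * coefsAt f B b i) ∷ []))
      ≈⟨ PS.sum-cong-≋ (λ s → PS.*-distribˡ-sum (φ s) (λ b → (coord (s# s) b * coefsAt f B b i) ∷ [])) ⟩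
    sumP (λ s → sumP (λ b → φ s *P ((coord (s# s) b * coefsAt f B b i) ∷ [])))
      ≈⟨ PS.∑-comm (λ s b → φ s *P ((coord (s# s) b * coefsAt f B b i) ∷ [])) ⟩
    sumP (λ b → sumP (λ s → φ s *P ((coord (s# s) b * coefsAt f B b i) ∷ [])))
      ≈⟨ PS.sum-cong-≋ (λ b → PS.sum-cong-≋ (λ s → ≋-trans
           (*P-congˡ (φ s) (≋-sym (monoT-* (coord (s# s) b) 0 (coefsAt f B b i) 0)))
           (≋-sym (*P-assoc (φ s) (coord (s# s) b ∷ []) (fB b i))))) ⟩
    sumP (λ b → sumP (λ s → (φ s *P (coord (s# s) b ∷ [])) *P fB b i))
      ≈⟨ PS.sum-cong-≋ (λ b → PS.*-distribʳ-sum (fB b i) (λ s → φ s *P (coord (s# s) b ∷ []))) ⟨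
    sumP (λ b → transfer e b *P fB b i) ∎
    where
    φ : Fin (length S) → QPoly
    φ s = shiftMono w e (s# s)

  shiftCoef-combination : ∀ {m} (α : Fin m → QPoly) (e : Fin m → Exp n) i →
    sumP (λ j → α j *P shiftCoef w f (e j) i) ≋ sumP (λ b → sumP (λ j → α j *P transfer (e j) b) *P fB b i)
  shiftCoef-combination α e i = begin
    sumP (λ j → α j *P shiftCoef w f (e j) i)
      ≈⟨ PS.sum-cong-≋ (λ j → ≋-trans (*P-congˡ (α j) (shiftCoef≋transfer (e j) i))
           (≋-trans (PS.*-distribˡ-sum (α j) (λ b → transfer (e j) b *P fB b i))
             (PS.sum-cong-≋ λ b → ≋-sym (*P-assoc (α j) (transfer (e j) b) (fB b i))))) ⟩
    sumP (λ j → sumP (λ b → (α j *P transfer (e j) b) *P fB b i))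
      ≈⟨ PS.∑-comm (λ j b → (α j *P transfer (e j) b) *P fB b i) ⟩
    sumP (λ b → sumP (λ j → (α j *P transfer (e j) b) *P fB b i))
      ≈⟨ PS.sum-cong-≋ (λ b → PS.*-distribʳ-sum (fB b i) (λ j → α j *P transfer (e j) b)) ⟨
    sumP (λ b → sumP (λ j → α j *P transfer (e j) b) *P fB b i) ∎

  -- The vectors are constant in t, so each power of t yields its own relation over ℚ.
  fB-independent : (p : Fin r → QPoly) → (∀ i → sumP (λ b → p b *P fB b i) ≋ []) → ∀ b → p b ≋ []
  fB-independent p rel b = coeffwise λ s → indep (λ b → coeffAt (p b) s) (λ i → trans
      (lincomb≡sum (λ b → coeffAt (p b) s) (coefsAt f B) i)
      (trans (QS.sum-cong-≗ (λ b → sym (coeffAt-*const (p b) (coefsAt f B b i) s)))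
        (trans (sym (coeffAt-sum (λ b → p b *P fB b i) s)) (at (rel i) s)))) b
    where
    coeffAt-*const : ∀ p x s → coeffAt (p *P (x ∷ [])) s ≡ coeffAt p s * x
    coeffAt-*const p x s = trans (at (≋-trans (*P-comm p (x ∷ [])) (≋-trans (+P-cong {scaleP x p} ≋-refl 0∷[]≋[]) (+P-identityʳ (scaleP x p)))) s)
      (trans (coeffAt-scale x p s) (QP.*-comm x (coeffAt p s)))

  -- Rescaling the transfer matrix and its value at t = 0

  a# : Fin (length A) → Exp n
  a# = lookup A

  T : ℕ → QPoly
  T = monoT 1ℚ

  -- The transfer matrix with row a multiplied by t^(w(a)) and column b by t^(-w(b)). Coordinates
  -- with w(s) < w(b) vanish, so no negative power occurs and `∸` is exact wherever the coefficient
  -- is nonzero.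
  normalized : Fin (length A) → Fin r → QPoly
  normalized a b = sumP (λ s → monoT (ι (binomProd (s# s) (a# a)) * coord (s# s) b) (weight w (s# s) ∸ weight w (b# b)))

  transfer-normalized : ∀ a b → T (weight w (a# a)) *P transfer (a# a) b ≋ T (weight w (b# b)) *P normalized a b
  transfer-normalized a b = begin
    T wa *P transfer e b
      ≈⟨ PS.*-distribˡ-sum (T wa) (λ s → shiftMono w e (s# s) *P (coord (s# s) b ∷ [])) ⟩
    sumP (λ s → T wa *P (shiftMono w e (s# s) *P (coord (s# s) b ∷ [])))
      ≈⟨ PS.sum-cong-≋ (λ s → term (s# s)) ⟩
    sumP (λ s → T wb *P monoT (ι (binomProd (s# s) e) * coord (s# s) b) (weight w (s# s) ∸ wb))
      ≈⟨ PS.*-distribˡ-sum (T wb) (λ s → monoT (ι (binomProd (s# s) e) * coord (s# s) b) (weight w (s# s) ∸ wb)) ⟨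
    T wb *P normalized a b ∎
    where
    e = a# a
    wa = weight w e
    wb = weight w (b# b)
    zeroes : ∀ {x} i j → x ≡ 0ℚ → monoT x i ≋ T wb *P monoT x j
    zeroes i j refl = ≋-trans (monoT-0 i) (≋-sym (≋-trans (*P-congˡ (T wb) (monoT-0 j)) (*P-zeroʳ (T wb))))
    T-* : ∀ i x j → T i *P monoT x j ≋ monoT x (i ℕ.+ j)
    T-* i x j = ≋-trans (monoT-* 1ℚ i x j) (monoT-cong (QP.*-identityˡ x) (i ℕ.+ j))
    term : ∀ m → T wa *P (shiftMono w e m *P (coord m b ∷ []))
      ≋ T wb *P monoT (ι (binomProd m e) * coord m b) (weight w m ∸ wb)
    term m = begin
      T wa *P (shiftMono w e m *P (coord m b ∷ []))     ≈⟨ *P-congˡ (T wa) (monoT-* (ι (binomProd m e)) d (coord m b) 0) ⟩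
      T wa *P monoT x (d ℕ.+ 0)                         ≈⟨ T-* wa x (d ℕ.+ 0) ⟩
      monoT x (wa ℕ.+ (d ℕ.+ 0))                        ≈⟨ compare ⟩
      T wb *P monoT x (weight w m ∸ wb)                 ∎
      where
      d = weight w (V.zipWith _∸_ m e)
      x = ι (binomProd m e) * coord m b
      -- If `e` is not below `m` the binomial is 0, and if w(m) < w(b) the coordinate is 0;
      -- otherwise both sides have exponent w(m).
      compare : monoT x (wa ℕ.+ (d ℕ.+ 0)) ≋ T wb *P monoT x (weight w m ∸ wb)
      compare with PW.decidable ℕ._≤?_ e m
      ... | no e⋠m = zeroes _ _ (trans (cong (_* coord m b) (trans (cong ι (binomProd-⋠ m e e⋠m)) (sym (ι-def 0)))) (QP.*-zeroˡ (coord m b)))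
      ... | yes e≼m with wb ℕ.≤? weight w m
      ...   | yes wb≤ = begin
          monoT x (wa ℕ.+ (d ℕ.+ 0))           ≡⟨ cong (monoT x) (trans (cong (wa ℕ.+_) (ℕP.+-identityʳ d)) (trans (ℕP.+-comm wa d) (weight-∸ w e≼m))) ⟩
          monoT x (weight w m)                 ≡⟨ cong (monoT x) (ℕP.m+[n∸m]≡n wb≤) ⟨
          monoT x (wb ℕ.+ (weight w m ∸ wb))   ≈⟨ T-* wb x (weight w m ∸ wb) ⟨
          T wb *P monoT x (weight w m ∸ wb)    ∎
      ...   | no wb≰ = zeroes _ _ (trans (cong (ι (binomProd m e) *_)
          (proj₂ (proj₂ (proj₂ (coordinates m))) b (λ { refl → wb≰ ℕP.≤-refl }) (ℕP.<⇒≤ (ℕP.≰⇒> wb≰))))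
          (QP.*-zeroʳ (ι (binomProd m e))))

  -- Exponents s with w(s) > w(b) carry a positive power of t, and among the others only s = b has a
  -- nonzero coordinate at b, namely 1.
  normalized-at0 : ∀ a b → coeffAt (normalized a b) 0 ≡ ι (binomProd (b# b) (a# a))
  normalized-at0 a b = trans (coeffAt-sum (λ s → N (s# s)) 0)
    (trans (sum-update (CommutativeRing.+-commutativeMonoid QP.+-*-commutativeRing) {φ = λ _ → 0ℚ} {λ m → coeffAt (N m) 0}
              (ι (binomProd (b# b) e)) S-unique (B⊆S b) same other)
      (trans (cong (ι (binomProd (b# b) e) +_) (QS.sum-replicate-zero (length S))) (QP.+-identityʳ _)))
    where
    e = a# a
    x : Exp n → ℚ
    x m = ι (binomProd m e) * coord m b
    N : Exp n → QPoly
    N m = monoT (x m) (weight w m ∸ weight w (b# b))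
    same : coeffAt (N (b# b)) 0 ≡ ι (binomProd (b# b) e) + 0ℚ
    same = trans (cong (λ d → coeffAt (monoT (x (b# b)) d) 0) (ℕP.n∸n≡0 (weight w (b# b))))
      (trans (cong (ι (binomProd (b# b) e) *_) (proj₁ (proj₂ (proj₂ (coordinates (b# b)))) b refl))
        (trans (QP.*-identityʳ (ι (binomProd (b# b) e))) (sym (QP.+-identityʳ (ι (binomProd (b# b) e))))))
    coeffAt-mono>0 : ∀ y d → 0 < d → coeffAt (monoT y d) 0 ≡ 0ℚ
    coeffAt-mono>0 y (suc d) _ = refl
    other : ∀ {m} → b# b ≢ m → coeffAt (N m) 0 ≡ 0ℚ
    other {m} b≢m with weight w m ℕ.≤? weight w (b# b)
    ... | yes le = trans (cong (λ y → coeffAt (monoT y (weight w m ∸ weight w (b# b))) 0)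
            (trans (cong (ι (binomProd m e) *_) (proj₂ (proj₂ (proj₂ (coordinates m))) b (b≢m ∘ sym) le)) (QP.*-zeroʳ (ι (binomProd m e)))))
          (at (monoT-0 (weight w m ∸ weight w (b# b))) 0)
    ... | no nle = coeffAt-mono>0 (x m) (weight w m ∸ weight w (b# b)) (ℕP.m<n⇒0<n∸m (ℕP.≰⇒> nle))

  normalized-injective₀ : ∀ c → (∀ b → sum (λ a → c a * coeffAt (normalized a b) 0) ≡ 0ℚ) → ∀ a → c a ≡ 0ℚ
  normalized-injective₀ c rel a with extend (std-unique B-unique) c
  ... | c' , c'≗c = trans (sym (c'≗c a)) (std-injective B-unique c' vanish (∈-lookup {xs = A} a))
    where
    vanish : ∀ {b} → b ∈ B → sum (λ i → c' (a# i) * ι (binomProd b (a# i))) ≡ 0ℚ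
    vanish {b} b∈ = trans (QS.sum-cong-≗ λ i → cong₂ _*_ (c'≗c i)
      (trans (cong (λ b → ι (binomProd b (a# i))) (lookup-index b∈)) (sym (normalized-at0 i (Any.index b∈)))))
      (rel (Any.index b∈))

  -- Multiplying row a by t^(w(a)) would divide `β a` by that power. A common bound W on the weights
  -- keeps the multipliers polynomial, as t^(W - w(a)) `β a`; the powers of t cancel afterwards.
  transfer-injective : (β : Fin (length A) → QPoly) →
    (∀ b → sumP (λ a → β a *P transfer (a# a) b) ≋ []) → ∀ a → β a ≋ []
  transfer-injective β rel a = *P-integral (β a) (T (W ∸ wt a))
    (≋-trans (*P-comm (β a) (T (W ∸ wt a))) (injectiveAt0⇒injective normalized normalized-injective₀ γ γ-rel a))
    (monoT-1≉0 (W ∸ wt a))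
    where
    wt : Fin (length A) → ℕ
    wt a = weight w (a# a)
    W = proj₁ (bounded wt)
    wt≤W = proj₂ (bounded wt)
    γ : Fin (length A) → QPoly
    γ a = T (W ∸ wt a) *P β a
    T-split : ∀ a → T (W ∸ wt a) *P T (wt a) ≋ T W
    T-split a = ≋-trans (monoT-* 1ℚ (W ∸ wt a) 1ℚ (wt a)) (R.reflexive (cong (monoT 1ℚ) (ℕP.m∸n+n≡m (wt≤W a))))
    γ-rel : ∀ b → sumP (λ a → γ a *P normalized a b) ≋ []
    γ-rel b = *P-integral _ (T wb) (≋-trans (*P-comm _ (T wb)) (begin
      T wb *P sumP (λ a → γ a *P normalized a b)
        ≈⟨ PS.*-distribˡ-sum (T wb) (λ a → γ a *P normalized a b) ⟩
      sumP (λ a → T wb *P (γ a *P normalized a b))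
        ≈⟨ PS.sum-cong-≋ step ⟩
      sumP (λ a → T W *P (β a *P transfer (a# a) b))
        ≈⟨ PS.*-distribˡ-sum (T W) (λ a → β a *P transfer (a# a) b) ⟨
      T W *P sumP (λ a → β a *P transfer (a# a) b)
        ≈⟨ *P-congˡ (T W) (rel b) ⟩
      T W *P []
        ≈⟨ *P-zeroʳ (T W) ⟩
      [] ∎)) (monoT-1≉0 wb)
      where
      wb = weight w (b# b)
      lem₁ : ∀ t u β m → t *P ((u *P β) *P m) ≋ (u *P β) *P (t *P m)
      lem₁ = solve-∀ QPoly-ring
      lem₂ : ∀ u β t m → (u *P β) *P (t *P m) ≋ (u *P t) *P (β *P m)
      lem₂ = solve-∀ QPoly-ring
      step : ∀ a → T wb *P (γ a *P normalized a b) ≋ T W *P (β a *P transfer (a# a) b)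
      step a = begin
        T wb *P (γ a *P normalized a b)                                  ≈⟨ lem₁ (T wb) (T (W ∸ wt a)) (β a) (normalized a b) ⟩
        γ a *P (T wb *P normalized a b)                                  ≈⟨ *P-congˡ (γ a) (transfer-normalized a b) ⟨
        γ a *P (T (wt a) *P transfer (a# a) b)                           ≈⟨ lem₂ (T (W ∸ wt a)) (β a) (T (wt a)) (transfer (a# a) b) ⟩
        (T (W ∸ wt a) *P T (wt a)) *P (β a *P transfer (a# a) b)         ≈⟨ *P-cong (T-split a) ≋-refl ⟩
        T W *P (β a *P transfer (a# a) b)                                ∎

  independent : LinIndepT (λ j → shiftCoef w f (a# j))
  independent α rel j = ≋[]⇒isZero (num (α j)) (β-zero j (transfer-injective β (fB-independent _ λ i → begin
      sumP (λ b → sumP (λ j → β j *P transfer (a# j) b) *P fB b i)   ≈⟨ shiftCoef-combination β a# i ⟨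
      sumP (λ j → β j *P shiftCoef w f (a# j) i)                     ≈⟨ β-sum (λ j → shiftCoef w f (a# j)) i ⟨
      l i                                                            ≈⟨ R.*-identityʳ (l i) ⟨
      l i *P (1ℚ ∷ [])                                               ≈⟨ coeffwise (rel i) ⟩
      []                                                             ∎) j))
    where
    cleared = clearDenominators α
    β = proj₁ cleared
    β-zero = proj₁ (proj₂ cleared)
    β-sum : ∀ {k} (v : Fin (length A) → PVec k) i → proj₁ (lincombR α v i) ≋ sumP (λ j → β j *P v j i)
    β-sum = proj₂ (proj₂ cleared)
    l : Fin k → QPoly
    l i = proj₁ (lincombR α (λ j → shiftCoef w f (a# j)) i)

  spanning : ∀ m → InSpanT (shiftCoef w f m) (λ j → shiftCoef w f (a# j))
  spanning m = coefficients , λ i → at (in-span i)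
    where
    e : Fin (suc (length A)) → Exp n
    e zero    = m
    e (suc j) = a# j
    -- The equality |A| = |B| enters here: there is one more vector than there are coordinates.
    relation = linearRelation (ℕP.≤-reflexive (cong suc (sym (length-std B)))) (λ j b → transfer (e j) b)
    α = proj₁ relation
    j₀ = proj₁ (proj₁ (proj₂ relation))
    α≉0 = proj₂ (proj₁ (proj₂ relation))
    rel : ∀ b → sumP (λ j → α j *P transfer (e j) b) ≋ []
    rel = proj₂ (proj₂ relation)
    δ = α zero
    -- With coefficient 0 at `m`, the relation would involve the rows of A alone and hence be
    -- trivial.
    δ≉0 : ¬ δ ≋ []
    δ≉0 z = α≉0 (all-zero j₀)
      where
      all-zero : ∀ j → α j ≋ []
      all-zero zero    = z
      all-zero (suc j) = transfer-injective (α ∘ suc) (λ b → ≋-trans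
        (+P-cong {p = []} (≋-sym (*P-cong {q = transfer m b} z ≋-refl)) ≋-refl) (rel b)) j
    δ≢0 : ¬ IsZeroP δ
    δ≢0 = δ≉0 ∘ isZero⇒≋[]
    ν : Fin (length A) → QPoly
    ν j = -P α (suc j)
    coefficients : Fin (length A) → RatFun
    coefficients j = ν j ⟋ δ ∣ δ≢0
    u : Fin (length A) → PVec k
    u j = shiftCoef w f (a# j)
    shift-rel : ∀ i → sumP (λ j → α j *P shiftCoef w f (e j) i) ≋ []
    shift-rel i = ≋-trans (shiftCoef-combination α e i) (sumP-zero λ b → *P-cong {q = fB b i} (rel b) ≋-refl)
    neg-sum : ∀ {r} (x y : Fin r → QPoly) → sumP (λ j → (-P x j) *P y j) ≋ -P sumP (λ j → x j *P y j)
    neg-sum {zero}  x y = ≋-refl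
    neg-sum {suc r} x y = ≋-trans (+P-cong ≋-refl (neg-sum (x ∘ suc) (y ∘ suc))) (lem (x zero) (y zero) _)
      where
      lem : ∀ x y s → ((-P x) *P y) +P (-P s) ≋ -P ((x *P y) +P s)
      lem = solve-∀ QPoly-ring
    solved : ∀ i → δ *P shiftCoef w f m i ≋ sumP (λ j → ν j *P u j i)
    solved i = begin
      x              ≈⟨ lem x s ⟩
      (x +P s) +P (-P s)   ≈⟨ +P-cong (shift-rel i) ≋-refl ⟩
      -P s           ≈⟨ neg-sum (α ∘ suc) (λ j → u j i) ⟨
      sumP (λ j → ν j *P u j i) ∎
      where
      x = δ *P shiftCoef w f m i
      s = sumP (λ j → α (suc j) *P u j i)
      lem : ∀ x s → x ≋ (x +P s) +P (-P s)
      lem = solve-∀ QPoly-ring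
    -- Both sides agree after multiplication by δ, by `solved` and `lincombR-commonDen`, and δ
    -- cancels in a domain.
    in-span : ∀ i → shiftCoef w f m i *P proj₂ (lincombR coefficients u i) ≋ proj₁ (lincombR coefficients u i) *P (1ℚ ∷ [])
    in-span i = ≋-trans (p-q≋0⇒p≋q (g *P q) p (*P-integral _ δ (begin
        ((g *P q) +P (-P p)) *P δ         ≈⟨ lem₁ g q p δ ⟩
        (q *P (δ *P g)) +P (-P (δ *P p))  ≈⟨ +P-cong (*P-congˡ q (solved i)) (-P-cong (lincombR-commonDen ν δ δ≢0 u i)) ⟩
        (q *P s) +P (-P (q *P s))         ≈⟨ -P-inverseʳ (q *P s) ⟩
        [] ∎) δ≉0)) (≋-sym (R.*-identityʳ p))
      where
      g = shiftCoef w f m i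
      p = proj₁ (lincombR coefficients u i)
      q = proj₂ (lincombR coefficients u i)
      s = sumP (λ j → ν j *P u j i)
      lem₁ : ∀ g q p δ → ((g *P q) +P (-P p)) *P δ ≋ (q *P (δ *P g)) +P (-P (δ *P p))
      lem₁ = solve-∀ QPoly-ring

theorem5 : (n k : ℕ) (f : Poly n k) (w : Vec ℕ n) →
    BasisIsolating w f → HasConeClosedBasis (shiftCoef w f)
theorem5 n k f w isolation = A , std-coneClosed B , independent , spanning
  where open ShiftedBasis f w isolation
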